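{- Let $\mathsf{M}$ be a coloopless matroid of corank $2$ and cardinality $n$. Then $Z_{\mathsf{M}}(t)$ is coefficient-wise smaller than or equal to $Z_{\mathsf{U}_{n-2,n}}(t)$; that is, for every $i$, the coefficient of $t^i$ in $Z_{\mathsf{M}}(t)$ is at most the coefficient of $t^i$ in $Z_{\mathsf{U}_{n-2,n}}(t)$.
   Context: $\mathsf{U}_{k,n}$ is the uniform matroid of rank $k$ on $n$ elements; corank $2$ means $\mathsf{M}$ has rank $n-2$. $Z$-polynomials: there is a unique way to assign to each loopless matroid $\mathsf{M}$ a polynomial $P_{\mathsf{M}}(t)\in\mathbb{Z}[t]$ (the Kazhdan–Lusztig polynomial) such that: (i) if $\operatorname{rk}(\mathsf{M})=0$ then $P_{\mathsf{M}}(t)=1$; (ii) if $\operatorname{rk}(\mathsf{M})>0$ then $\deg P_{\mathsf{M}}<\frac12\operatorname{rk}(\mathsf{M})$; (iii) for every loopless $\mathsf{M}$, the polynomial $Z_{\mathsf{M}}(t)=\sum_{F}t^{\operatorname{rk}(F)}P_{\mathsf{M}/F}(t)$, summed over all flats $F$ of $\mathsf{M}$, is palindromic, i.e. $t^{\operatorname{rk}(\mathsf{M})}Z_{\mathsf{M}}(t^{ -1})=Z_{\mathsf{M}}(t)$. $Z_{\mathsf{M}}$ is the $Z$-polynomial of $\mathsf{M}$. Convention: for matroids with loops, $P_{\mathsf{M}}=Z_{\mathsf{M}}=0$. -}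

module Defs where

open import Data.Bool.Base using (true; false)
open import Data.Fin.Base using (Fin)
open import Data.Fin.Properties using (all?)
open import Data.Fin.Subset
open import Data.Fin.Subset.Properties
open import Data.Integer.Base as ℤ using (ℤ)
import Data.Integer.Properties as ℤ
open import Data.List.Base using (List; []; _∷_; applyUpTo)
open import Data.Nat.Base using (ℕ; zero; suc; _+_; _*_; _∸_; _⊓_; _≤_; _<_; z≤n; s≤s)
open import Data.Nat.Properties
open import Data.Product.Base using (_×_; _,_; proj₁; proj₂)
open import Data.Sum.Base using (inj₁; inj₂; [_,_]′)
open import Data.Vec.Base using ([]; _∷_)
open import Data.Vec.Properties using (≡-dec)
import Data.Bool.Properties as Bool
open import Function.Base using (_∘_; id)
open import Relation.Binary.PropositionalEquality
open import Relation.Nullary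
open import Relation.Binary.Definitions using (tri<; tri≈; tri>)

------------------------------------------------------------------------
-- Matroids

-- A matroid on a finite ground set, which is a subset of Fin N so that
-- contractions need no relabelling.  The rank function is meaningful only
-- on subsets of the ground set.

record Matroid (N : ℕ) : Set where
  field
    ground          : Subset N
    rank            : Subset N → ℕ
    rank-≤-card     : ∀ A → A ⊆ ground → rank A ≤ ∣ A ∣
    rank-mono       : ∀ A B → A ⊆ B → B ⊆ ground → rank A ≤ rank B
    rank-submodular : ∀ A B → A ⊆ ground → B ⊆ ground →
                      rank (A ∪ B) + rank (A ∩ B) ≤ rank A + rank B

open Matroid public

rk : ∀ {N} → Matroid N → ℕ
rk M = rank M (ground M)

module _ {N : ℕ} (M : Matroid N) where

  IsIndependent : Subset N → Set
  IsIndependent A = A ⊆ ground M × rank M A ≡ ∣ A ∣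

  IsBasis : Subset N → Set
  IsBasis B = IsIndependent B × rank M B ≡ rk M

  IsLoop : Fin N → Set
  IsLoop x = x ∈ ground M × rank M ⁅ x ⁆ ≡ 0

  IsColoop : Fin N → Set
  IsColoop x = x ∈ ground M × (∀ B → IsBasis B → x ∈ B)

  Loopless : Set
  Loopless = ∀ x → ¬ IsLoop x

  Coloopless : Set
  Coloopless = ∀ x → ¬ IsColoop x

  IsFlat : Subset N → Set
  IsFlat F = F ⊆ ground M ×
             (∀ x → x ∈ ground M → x ∉ F → rank M F < rank M (F ∪ ⁅ x ⁆))

  loopless? : Dec Loopless
  loopless? = all? λ x → ¬? ((x ∈? ground M) ×-dec (rank M ⁅ x ⁆ ≟ 0))

  isFlat? : ∀ F → Dec (IsFlat F)
  isFlat? F = (F ⊆? ground M) ×-dec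
    all? λ x → (x ∈? ground M) →-dec (¬? (x ∈? F) →-dec
               (rank M F <? rank M (F ∪ ⁅ x ⁆)))

-- Equality of matroids on the same ground set.
infix 4 _≋_
_≋_ : ∀ {N} → Matroid N → Matroid N → Set
M ≋ M′ = ground M ≡ ground M′ × (∀ A → A ⊆ ground M → rank M A ≡ rank M′ A)

private
  ∪-lub : ∀ {n} {p q r : Subset n} → p ⊆ r → q ⊆ r → p ∪ q ⊆ r
  ∪-lub {p = p} {q} p⊆r q⊆r x∈ = [ p⊆r , q⊆r ]′ (x∈p∪q⁻ p q x∈)

  ∪-monoˡ : ∀ {n} {p q : Subset n} r → p ⊆ q → p ∪ r ⊆ q ∪ r
  ∪-monoˡ {p = p} {q} r p⊆q =
    ∪-lub {p = p} {r} {q ∪ r} (p⊆p∪q r ∘ p⊆q) (q⊆p∪q q r)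

contract : ∀ {N} (M : Matroid N) (F : Subset N) → F ⊆ ground M → Matroid N
contract M F F⊆E = record
  { ground          = ground M ─ F
  ; rank            = λ A → rank M (A ∪ F) ∸ rank M F
  ; rank-≤-card     = λ A A⊆ → m≤n+o⇒m∸n≤o (rank M (A ∪ F)) (rank M F)
      (begin
        rank M (A ∪ F)                    ≤⟨ m≤m+n _ _ ⟩
        rank M (A ∪ F) + rank M (A ∩ F)   ≤⟨ rank-submodular M A F (E A A⊆) F⊆E ⟩
        rank M A + rank M F               ≤⟨ +-monoˡ-≤ _ (rank-≤-card M A (E A A⊆)) ⟩
        ∣ A ∣ + rank M F                  ≡⟨ +-comm ∣ A ∣ _ ⟩
        rank M F + ∣ A ∣                  ∎)
  ; rank-mono       = λ A B A⊆B B⊆ → ∸-monoˡ-≤ (rank M F)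
      (rank-mono M _ _ (∪-monoˡ F A⊆B) (E∪ B B⊆))
  ; rank-submodular = λ A B A⊆ B⊆ → shifted
      (above A A⊆) (above B B⊆)
      (above (A ∪ B) (∪-lub {p = A} {B} A⊆ B⊆))
      (above (A ∩ B) (A⊆ ∘ p∩q⊆p A B))
      (subst₂ (λ X Y → rank M X + rank M Y ≤ rank M (A ∪ F) + rank M (B ∪ F))
        (∪-distribʳ-∪ A B) (sym (∪-distribʳ-∩ F A B))
        (rank-submodular M (A ∪ F) (B ∪ F) (E∪ A A⊆) (E∪ B B⊆)))
  }
  where
  open ≤-Reasoning

  E : ∀ A → A ⊆ ground M ─ F → A ⊆ ground M
  E A A⊆ = p─q⊆p (ground M) F ∘ A⊆

  E∪ : ∀ A → A ⊆ ground M ─ F → A ∪ F ⊆ ground M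
  E∪ A A⊆ = ∪-lub {p = A} {F} (E A A⊆) F⊆E

  above : ∀ A → A ⊆ ground M ─ F → rank M F ≤ rank M (A ∪ F)
  above A A⊆ = rank-mono M _ _ (q⊆p∪q A F) (E∪ A A⊆)

  ∪-distribʳ-∪ : ∀ A B → (A ∪ F) ∪ (B ∪ F) ≡ (A ∪ B) ∪ F
  ∪-distribʳ-∪ A B = ⊆-antisym
    (∪-lub {p = A ∪ F} {B ∪ F} (∪-monoˡ F (p⊆p∪q B)) (∪-monoˡ F (q⊆p∪q A B)))
    (∪-lub {p = A ∪ B} {F}
      (∪-lub {p = A} {B} (p⊆p∪q (B ∪ F) ∘ p⊆p∪q F) (q⊆p∪q (A ∪ F) (B ∪ F) ∘ p⊆p∪q F))
      (p⊆p∪q (B ∪ F) ∘ q⊆p∪q A F))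

  shifted : ∀ {f a b u i} → f ≤ a → f ≤ b → f ≤ u → f ≤ i → u + i ≤ a + b →
            (u ∸ f) + (i ∸ f) ≤ (a ∸ f) + (b ∸ f)
  shifted {f} {a} {b} {u} {i} fa fb fu fi le = begin
    (u ∸ f) + (i ∸ f) ≡⟨ pull u i fu fi ⟩
    (u + i) ∸ f ∸ f   ≤⟨ ∸-monoˡ-≤ f (∸-monoˡ-≤ f le) ⟩
    (a + b) ∸ f ∸ f   ≡⟨ pull a b fa fb ⟨
    (a ∸ f) + (b ∸ f) ∎
    where
    pull : ∀ x y → f ≤ x → f ≤ y → (x ∸ f) + (y ∸ f) ≡ (x + y) ∸ f ∸ f
    pull x y fx fy = trans (sym (+-∸-assoc (x ∸ f) fy))
                           (cong (_∸ f) (sym (+-∸-comm y fx)))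

-- U_{k,n}, for k ≤ n; if k > n this has rank n.

uniform : (k n : ℕ) → Matroid n
uniform k n = record
  { ground          = ⊤
  ; rank            = λ A → ∣ A ∣ ⊓ k
  ; rank-≤-card     = λ A _ → m⊓n≤m ∣ A ∣ k
  ; rank-mono       = λ A B A⊆B _ → ⊓-monoˡ-≤ k (p⊆q⇒∣p∣≤∣q∣ A⊆B)
  ; rank-submodular = λ A B _ _ → truncated
      (∣p∩q∣≤∣p∣ A B) (∣p∩q∣≤∣q∣ A B) (≤-reflexive (modular A B))
  }
  where
  modular : ∀ {n} (A B : Subset n) → ∣ A ∪ B ∣ + ∣ A ∩ B ∣ ≡ ∣ A ∣ + ∣ B ∣
  modular []          []          = refl
  modular (false ∷ A) (false ∷ B) = modular A B
  modular (false ∷ A) (true  ∷ B) = trans (cong suc (modular A B)) (sym (+-suc ∣ A ∣ ∣ B ∣))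
  modular (true  ∷ A) (false ∷ B) = cong suc (modular A B)
  modular (true  ∷ A) (true  ∷ B) = cong suc (trans (+-suc _ _)
    (trans (cong suc (modular A B)) (sym (+-suc ∣ A ∣ ∣ B ∣))))

  truncated : ∀ {a b u i} → i ≤ a → i ≤ b → u + i ≤ a + b →
              u ⊓ k + i ⊓ k ≤ a ⊓ k + b ⊓ k
  truncated {a} {b} {u} {i} ia ib le with ≤-total a k | ≤-total b k
  ... | inj₁ ak | inj₁ bk rewrite m≤n⇒m⊓n≡m ak | m≤n⇒m⊓n≡m bk =
    ≤-trans (+-mono-≤ (m⊓n≤m u k) (m⊓n≤m i k)) le
  ... | inj₁ ak | inj₂ kb rewrite m≤n⇒m⊓n≡m ak | m≥n⇒m⊓n≡n kb | +-comm a k =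
    +-mono-≤ (m⊓n≤n u k) (≤-trans (m⊓n≤m i k) ia)
  ... | inj₂ ka | inj₁ bk rewrite m≥n⇒m⊓n≡n ka | m≤n⇒m⊓n≡m bk =
    +-mono-≤ (m⊓n≤n u k) (≤-trans (m⊓n≤m i k) ib)
  ... | inj₂ ka | inj₂ kb rewrite m≥n⇒m⊓n≡n ka | m≥n⇒m⊓n≡n kb =
    +-mono-≤ (m⊓n≤n u k) (m⊓n≤n i k)

------------------------------------------------------------------------
-- Polynomials in ℤ[t], as lists of coefficients starting with the constant
-- term.  Trailing zeros are allowed, so equality is equality of coefficients.

Poly : Set
Poly = List ℤ

coeff : Poly → ℕ → ℤ
coeff []      _       = ℤ.0ℤ
coeff (a ∷ p) zero    = a
coeff (a ∷ p) (suc i) = coeff p i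

infix 4 _≈_
_≈_ : Poly → Poly → Set
p ≈ q = ∀ i → coeff p i ≡ coeff q i

infixl 6 _⊕_
_⊕_ : Poly → Poly → Poly
[]      ⊕ q       = q
(a ∷ p) ⊕ []      = a ∷ p
(a ∷ p) ⊕ (b ∷ q) = (a ℤ.+ b) ∷ (p ⊕ q)

t^_·_ : ℕ → Poly → Poly
t^ zero  · p = p
t^ suc k · p = ℤ.0ℤ ∷ (t^ k · p)

-- deg p < r / 2, with deg 0 = -∞.
2deg_<_ : Poly → ℕ → Set
2deg p < r = ∀ i → r ≤ 2 * i → coeff p i ≡ ℤ.0ℤ

-- t^r p(t⁻¹) = p(t) as Laurent polynomials: the coefficient of t^i on the
-- left is that of t^(r-i) in p, which is 0 for i > r.
Palindromic : ℕ → Poly → Set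
Palindromic r p = (∀ i → i ≤ r → coeff p (r ∸ i) ≡ coeff p i)
                × (∀ i → r < i → coeff p i ≡ ℤ.0ℤ)

sumOverSubsets : ∀ N → (Subset N → Poly) → Poly
sumOverSubsets zero    f = f []
sumOverSubsets (suc N) f = sumOverSubsets N (f ∘ (outside ∷_))
                         ⊕ sumOverSubsets N (f ∘ (inside ∷_))

------------------------------------------------------------------------
-- Z-polynomials and Kazhdan–Lusztig polynomials

Assignment : Set
Assignment = ∀ {N} → Matroid N → Poly

module _ (P : Assignment) where

  flatTerm : ∀ {N} → Matroid N → Subset N → Poly
  flatTerm M F with isFlat? M F
  ... | yes (F⊆E , _) = t^ rank M F · P (contract M F F⊆E)
  ... | no  _         = []

  Z : Assignment
  Z {N} M with loopless? M
  ... | yes _ = sumOverSubsets N (flatTerm M)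
  ... | no  _ = []

  -- An assignment must be a function of the matroid, which is the content of
  -- respects-≋: without it, it could depend on the proofs in the record or
  -- on the values of the rank function outside the ground set.  The field
  -- loops is the convention for matroids with loops.
  record IsKazhdanLusztig : Set where
    field
      respects-≋  : ∀ {N} (M M′ : Matroid N) → M ≋ M′ → P M ≈ P M′
      rank-zero   : ∀ {N} (M : Matroid N) → Loopless M → rk M ≡ 0 → P M ≈ ℤ.1ℤ ∷ []
      degree      : ∀ {N} (M : Matroid N) → Loopless M → 0 < rk M → 2deg P M < rk M
      palindromic : ∀ {N} (M : Matroid N) → Loopless M → Palindromic (rk M) (Z M)
      loops       : ∀ {N} (M : Matroid N) → ¬ Loopless M → P M ≈ []

------------------------------------------------------------------------
-- Existence and uniqueness of the assignment

coeff-⊕ : ∀ p q i → coeff (p ⊕ q) i ≡ coeff p i ℤ.+ coeff q i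
coeff-⊕ []      q       i       = sym (ℤ.+-identityˡ _)
coeff-⊕ (a ∷ p) []      i       = sym (ℤ.+-identityʳ _)
coeff-⊕ (a ∷ p) (b ∷ q) zero    = refl
coeff-⊕ (a ∷ p) (b ∷ q) (suc i) = coeff-⊕ p q i

⊕-cong : ∀ p p′ q q′ → p ≈ p′ → q ≈ q′ → p ⊕ q ≈ p′ ⊕ q′
⊕-cong p p′ q q′ e e′ i =
  trans (coeff-⊕ p q i) (trans (cong₂ ℤ._+_ (e i) (e′ i)) (sym (coeff-⊕ p′ q′ i)))

t^-cong : ∀ k {p q} → p ≈ q → t^ k · p ≈ t^ k · q
t^-cong zero    e i       = e i
t^-cong (suc k) e zero    = refl
t^-cong (suc k) e (suc i) = t^-cong k e i

t^-bound : ∀ k {p d} → (∀ i → d < i → coeff p i ≡ ℤ.0ℤ) →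
           ∀ i → k + d < i → coeff (t^ k · p) i ≡ ℤ.0ℤ
t^-bound zero    e i       d<i       = e i d<i
t^-bound (suc k) e (suc i) (s≤s d<i) = t^-bound k e i d<i

sum-cong : ∀ N (f g : Subset N → Poly) → (∀ F → f F ≈ g F) →
           sumOverSubsets N f ≈ sumOverSubsets N g
sum-cong zero    f g e = e []
sum-cong (suc N) f g e = ⊕-cong
  (sumOverSubsets N (f ∘ (outside ∷_))) (sumOverSubsets N (g ∘ (outside ∷_)))
  (sumOverSubsets N (f ∘ (inside ∷_)))  (sumOverSubsets N (g ∘ (inside ∷_)))
  (sum-cong N _ _ (λ F → e (outside ∷ F))) (sum-cong N _ _ (λ F → e (inside ∷ F)))

sum-bound : ∀ N {f d} → (∀ F i → d < i → coeff (f F) i ≡ ℤ.0ℤ) →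
            ∀ i → d < i → coeff (sumOverSubsets N f) i ≡ ℤ.0ℤ
sum-bound zero    e i d<i = e [] i d<i
sum-bound (suc N) {f} e i d<i =
  trans (coeff-⊕ (sumOverSubsets N (f ∘ (outside ∷_))) _ i)
        (cong₂ ℤ._+_ (sum-bound N (λ F → e (outside ∷ F)) i d<i)
                     (sum-bound N (λ F → e (inside ∷ F)) i d<i))

sum-split : ∀ N {f g} → g ⊥ ≈ [] → (∀ F → F ≢ ⊥ → f F ≈ g F) →
            ∀ i → coeff (sumOverSubsets N f) i ≡ coeff (f ⊥) i ℤ.+ coeff (sumOverSubsets N g) i
sum-split zero {f} {g} e h i =
  sym (trans (cong (ℤ._+_ (coeff (f []) i)) (e i)) (ℤ.+-identityʳ (coeff (f []) i)))
sum-split (suc N) {f} {g} e h i = begin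
  coeff (Σ f out ⊕ Σ f inn) i                       ≡⟨ coeff-⊕ (Σ f out) _ i ⟩
  coeff (Σ f out) i ℤ.+ coeff (Σ f inn) i           ≡⟨ cong₂ ℤ._+_
      (sum-split N e (λ F F≢ → h (outside ∷ F) (λ { refl → F≢ refl })) i)
      (sum-cong N (f ∘ inn) (g ∘ inn) (λ F → h (inside ∷ F) (λ ())) i) ⟩
  coeff (f ⊥) i ℤ.+ coeff (Σ g out) i ℤ.+ coeff (Σ g inn) i   ≡⟨ ℤ.+-assoc (coeff (f ⊥) i) _ _ ⟩
  coeff (f ⊥) i ℤ.+ (coeff (Σ g out) i ℤ.+ coeff (Σ g inn) i) ≡⟨ cong (ℤ._+_ (coeff (f ⊥) i)) (coeff-⊕ (Σ g out) _ i) ⟨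
  coeff (f ⊥) i ℤ.+ coeff (Σ g out ⊕ Σ g inn) i     ∎
  where
  open ≡-Reasoning
  out inn : Subset N → Subset (suc N)
  out = outside ∷_
  inn = inside ∷_
  Σ : (Subset (suc N) → Poly) → (Subset N → Subset (suc N)) → Poly
  Σ f s = sumOverSubsets N (f ∘ s)

private
  ⁅⁆⊆ : ∀ {N} {E : Subset N} {x} → x ∈ E → ⁅ x ⁆ ⊆ E
  ⁅⁆⊆ {x = x} x∈E y∈ rewrite x∈⁅y⁆⇒x≡y x y∈ = x∈E

  ─-∪ : ∀ {N} (E F : Subset N) → F ⊆ E → (E ─ F) ∪ F ≡ E
  ─-∪ E F F⊆E = ⊆-antisym (∪-lub {p = E ─ F} {F} (p─q⊆p E F) F⊆E) back
    where
    back : E ⊆ (E ─ F) ∪ F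
    back {x} x∈E with x ∈? F
    ... | yes x∈F = q⊆p∪q (E ─ F) F x∈F
    ... | no  x∉F = p⊆p∪q F (x∈p∧x∉q⇒x∈p─q x∈E x∉F)

≋-refl : ∀ {N} (M : Matroid N) → M ≋ M
≋-refl M = refl , λ _ _ → refl

≋-sym : ∀ {N} (M M′ : Matroid N) → M ≋ M′ → M′ ≋ M
≋-sym M M′ (g , r) = sym g , λ A A⊆ → sym (r A (subst (A ⊆_) (sym g) A⊆))

≋-rk : ∀ {N} (M M′ : Matroid N) → M ≋ M′ → rk M ≡ rk M′
≋-rk M M′ (g , r) = trans (r _ id) (cong (rank M′) g)

≋-loopless : ∀ {N} (M M′ : Matroid N) → M ≋ M′ → Loopless M → Loopless M′
≋-loopless M M′ (g , r) ll x (x∈ , l) =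
  ll x (x∈E , trans (r _ (⁅⁆⊆ x∈E)) l)
  where x∈E = subst (x ∈_) (sym g) x∈

≋-flat : ∀ {N} (M M′ : Matroid N) → M ≋ M′ → ∀ F → IsFlat M F → IsFlat M′ F
≋-flat M M′ (g , r) F (F⊆E , cl) = subst (F ⊆_) g F⊆E , λ x x∈ x∉F →
  let x∈E = subst (x ∈_) (sym g) x∈ in
  subst₂ _<_ (r F F⊆E) (r _ (∪-lub {p = F} F⊆E (⁅⁆⊆ x∈E))) (cl x x∈E x∉F)

≋-contract : ∀ {N} (M M′ : Matroid N) → M ≋ M′ → ∀ F (h : F ⊆ ground M) (h′ : F ⊆ ground M′) →
             contract M F h ≋ contract M′ F h′
≋-contract M M′ (g , r) F h h′ = cong (_─ F) g , λ A A⊆ →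
  cong₂ _∸_ (r _ (∪-lub {p = A} (p─q⊆p (ground M) F ∘ A⊆) h)) (r F h)

rank-⊥ : ∀ {N} (M : Matroid N) → rank M ⊥ ≡ 0
rank-⊥ {N} M = n≤0⇒n≡0 (≤-trans (rank-≤-card M ⊥ (⊆-min _)) (≤-reflexive (∣⊥∣≡0 N)))

contract-⊥ : ∀ {N} (M : Matroid N) (h : ⊥ ⊆ ground M) → contract M ⊥ h ≋ M
contract-⊥ M h = p─⊥≡p _ , λ A _ →
  cong₂ _∸_ (cong (rank M) (∪-identityʳ A)) (rank-⊥ M)

rk-contract : ∀ {N} (M : Matroid N) F (h : F ⊆ ground M) → rk (contract M F h) ≡ rk M ∸ rank M F
rk-contract M F h = cong (λ X → rank M X ∸ rank M F) (─-∪ (ground M) F h)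

loopless-rank>0 : ∀ {N} (M : Matroid N) → Loopless M → ∀ A → A ⊆ ground M → A ≢ ⊥ → 0 < rank M A
loopless-rank>0 M ll A A⊆ A≢⊥ with nonempty? A
... | no  ¬ne      = contradiction (Empty-unique ¬ne) A≢⊥
... | yes (x , x∈) = ≤-trans (n≢0⇒n>0 (λ l → ll x (A⊆ x∈ , l)))
                             (rank-mono M _ _ (⁅⁆⊆ x∈) A⊆)

rk-contract-< : ∀ {N} (M : Matroid N) → Loopless M → ∀ F (h : F ⊆ ground M) → F ≢ ⊥ → rk (contract M F h) < rk M
rk-contract-< M ll F h F≢⊥ rewrite rk-contract M F h =
  ∸-monoʳ-< (loopless-rank>0 M ll F h F≢⊥) (rank-mono M F (ground M) h id)

⊥-flat : ∀ {N} (M : Matroid N) → Loopless M → IsFlat M ⊥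
⊥-flat M ll = ⊆-min _ , λ x x∈ _ →
  subst (_< rank M (⊥ ∪ ⁅ x ⁆)) (sym (rank-⊥ M))
    (loopless-rank>0 M ll _ (∪-lub {p = ⊥} (⊆-min _) (⁅⁆⊆ x∈))
      λ e → ∉⊥ (subst (x ∈_) e (q⊆p∪q ⊥ ⁅ x ⁆ (x∈⁅x⁆ x))))

module _ (P : Assignment) where

  properTerm : ∀ {N} → Matroid N → Subset N → Poly
  properTerm M F with ≡-dec Bool._≟_ F ⊥
  ... | yes _ = []
  ... | no  _ = flatTerm P M F

  properSum : Assignment
  properSum {N} M = sumOverSubsets N (properTerm M)

  properTerm-⊥ : ∀ {N} (M : Matroid N) → properTerm M ⊥ ≈ []
  properTerm-⊥ {N} M i with ≡-dec Bool._≟_ (⊥ {N}) ⊥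
  ... | yes _ = refl
  ... | no ¬e = contradiction refl ¬e

  properTerm-≢ : ∀ {N} (M : Matroid N) F → F ≢ ⊥ → flatTerm P M F ≈ properTerm M F
  properTerm-≢ M F F≢⊥ i with ≡-dec Bool._≟_ F ⊥
  ... | yes e = contradiction e F≢⊥
  ... | no _  = refl

  -- Z_M = P_M + Σ_{F ≠ ∅} t^{rk F} P_{M/F}
  Z-split : (∀ {N} (M M′ : Matroid N) → M ≋ M′ → P M ≈ P M′) →
            ∀ {N} (M : Matroid N) → Loopless M →
            ∀ i → coeff (Z P M) i ≡ coeff (P M) i ℤ.+ coeff (properSum M) i
  Z-split KL-resp {N} M ll i with loopless? M
  ... | no ¬ll = contradiction ll ¬ll
  ... | yes _  = trans (sum-split N (properTerm-⊥ M) (properTerm-≢ M) i)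
                       (cong (ℤ._+ coeff (properSum M) i) bottom)
    where
    bottom : coeff (flatTerm P M ⊥) i ≡ coeff (P M) i
    bottom with isFlat? M ⊥
    ... | no ¬f = contradiction (⊥-flat M ll) ¬f
    ... | yes (h , _) rewrite rank-⊥ M = KL-resp _ _ (contract-⊥ M h) i

completionTerm : ℕ → Poly → ℕ → ℤ
completionTerm r q i with 2 * i <? r
... | yes _ = coeff q (r ∸ i) ℤ.- coeff q i
... | no  _ = ℤ.0ℤ

-- The p of degree < r / 2 such that p + q is palindromic.
completion : ℕ → Poly → Poly
completion r q = applyUpTo (completionTerm r q) r

coeff-applyUpTo-< : ∀ f n {i} → i < n → coeff (applyUpTo f n) i ≡ f i
coeff-applyUpTo-< f (suc n) {zero}  _         = refl
coeff-applyUpTo-< f (suc n) {suc i} (s≤s i<n) = coeff-applyUpTo-< (f ∘ suc) n i<n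

coeff-applyUpTo-≥ : ∀ f n {i} → n ≤ i → coeff (applyUpTo f n) i ≡ ℤ.0ℤ
coeff-applyUpTo-≥ f zero            _         = refl
coeff-applyUpTo-≥ f (suc n) {suc i} (s≤s n≤i) = coeff-applyUpTo-≥ (f ∘ suc) n n≤i

completion-low : ∀ r q i → 2 * i < r → coeff (completion r q) i ≡ coeff q (r ∸ i) ℤ.- coeff q i
completion-low r q i 2i<r = trans (coeff-applyUpTo-< _ r (≤-<-trans (m≤m+n i _) 2i<r)) term
  where
  term : completionTerm r q i ≡ coeff q (r ∸ i) ℤ.- coeff q i
  term with 2 * i <? r
  ... | yes _ = refl
  ... | no ¬p = contradiction 2i<r ¬p

completion-high : ∀ r q → 2deg completion r q < r
completion-high r q i r≤2i with i <? r
... | no i≮r  = coeff-applyUpTo-≥ _ r (≮⇒≥ i≮r)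
... | yes i<r = trans (coeff-applyUpTo-< _ r i<r) term
  where
  term : completionTerm r q i ≡ ℤ.0ℤ
  term with 2 * i <? r
  ... | yes 2i<r = contradiction r≤2i (<⇒≱ 2i<r)
  ... | no _     = refl

completion-cong : ∀ {r r′} q q′ → r ≡ r′ → q ≈ q′ → completion r q ≈ completion r′ q′
completion-cong {r} q q′ refl e i with 2 * i <? r
... | yes lt = trans (completion-low r q i lt) (trans (cong₂ ℤ._-_ (e (r ∸ i)) (e i))
                 (sym (completion-low r q′ i lt)))
... | no ¬lt = trans (completion-high r q i (≮⇒≥ ¬lt)) (sym (completion-high r q′ i (≮⇒≥ ¬lt)))

private
  complement-high : ∀ {r i} → 2 * i ≤ r → r ≤ 2 * (r ∸ i)
  complement-high {r} {i} 2i≤r = begin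
    r                 ≡⟨ m+n∸n≡m r r ⟨
    (r + r) ∸ r       ≤⟨ ∸-monoʳ-≤ (r + r) 2i≤r ⟩
    (r + r) ∸ 2 * i   ≡⟨ cong (λ x → r + x ∸ 2 * i) (+-identityʳ r) ⟨
    2 * r ∸ 2 * i     ≡⟨ *-distribˡ-∸ 2 r i ⟨
    2 * (r ∸ i)       ∎
    where open ≤-Reasoning

  low-complement : ∀ {r i} → r < 2 * i → i ≤ r → 2 * (r ∸ i) < r
  low-complement {r} {i} gt i≤r = begin-strict
    2 * (r ∸ i)       ≡⟨ *-distribˡ-∸ 2 r i ⟩
    2 * r ∸ 2 * i     <⟨ ∸-monoʳ-< gt (*-monoʳ-≤ 2 i≤r) ⟩
    2 * r ∸ r         ≡⟨ cong (λ x → r + x ∸ r) (+-identityʳ r) ⟩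
    (r + r) ∸ r       ≡⟨ m+n∸n≡m r r ⟩
    r                 ∎
    where open ≤-Reasoning

  x-y+y : ∀ x y → x ℤ.- y ℤ.+ y ≡ x
  x-y+y x y = trans (ℤ.+-assoc x (ℤ.- y) y)
    (trans (cong (ℤ._+_ x) (ℤ.+-inverseˡ y)) (ℤ.+-identityʳ x))

  x+y-y : ∀ x y → x ℤ.+ y ℤ.- y ≡ x
  x+y-y x y = trans (ℤ.+-assoc x y (ℤ.- y))
    (trans (cong (ℤ._+_ x) (ℤ.+-inverseʳ y)) (ℤ.+-identityʳ x))

completion-palindromic : ∀ r q z →
  (∀ i → coeff z i ≡ coeff (completion r q) i ℤ.+ coeff q i) →
  ∀ i → i ≤ r → coeff z (r ∸ i) ≡ coeff z i
completion-palindromic r q z e i i≤r with <-cmp (2 * i) r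
... | tri< lt _ _ = sym (low i lt)
  where
  open ≡-Reasoning
  low : ∀ i → 2 * i < r → coeff z i ≡ coeff z (r ∸ i)
  low i lt = begin
    coeff z i                                                   ≡⟨ e i ⟩
    coeff (completion r q) i ℤ.+ coeff q i                      ≡⟨ cong (ℤ._+ coeff q i) (completion-low r q i lt) ⟩
    coeff q (r ∸ i) ℤ.- coeff q i ℤ.+ coeff q i                 ≡⟨ x-y+y _ (coeff q i) ⟩
    coeff q (r ∸ i)                                             ≡⟨ ℤ.+-identityˡ _ ⟨
    ℤ.0ℤ ℤ.+ coeff q (r ∸ i)                                    ≡⟨ cong (ℤ._+ coeff q (r ∸ i)) (completion-high r q (r ∸ i) (complement-high {i = i} (<⇒≤ lt))) ⟨
    coeff (completion r q) (r ∸ i) ℤ.+ coeff q (r ∸ i)          ≡⟨ e (r ∸ i) ⟨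
    coeff z (r ∸ i)                                             ∎
... | tri≈ _ eq _ = cong (coeff z) (trans (cong (_∸ i) (sym eq))
                      (trans (m+n∸m≡n i (i + 0)) (+-identityʳ i)))
... | tri> _ _ gt = begin
    coeff z (r ∸ i)                                             ≡⟨ e (r ∸ i) ⟩
    coeff (completion r q) (r ∸ i) ℤ.+ coeff q (r ∸ i)          ≡⟨ cong (ℤ._+ coeff q (r ∸ i)) (completion-low r q (r ∸ i) lt) ⟩
    coeff q (r ∸ (r ∸ i)) ℤ.- coeff q (r ∸ i) ℤ.+ coeff q (r ∸ i) ≡⟨ x-y+y _ (coeff q (r ∸ i)) ⟩
    coeff q (r ∸ (r ∸ i))                                       ≡⟨ cong (coeff q) (m∸[m∸n]≡n i≤r) ⟩
    coeff q i                                                   ≡⟨ ℤ.+-identityˡ _ ⟨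
    ℤ.0ℤ ℤ.+ coeff q i                                          ≡⟨ cong (ℤ._+ coeff q i) (completion-high r q i (<⇒≤ gt)) ⟨
    coeff (completion r q) i ℤ.+ coeff q i                      ≡⟨ e i ⟨
    coeff z i                                                   ∎
  where
  open ≡-Reasoning
  lt : 2 * (r ∸ i) < r
  lt = low-complement gt i≤r

completion-unique : ∀ r p q z → 2deg p < r →
  (∀ i → coeff z i ≡ coeff p i ℤ.+ coeff q i) →
  (∀ i → i ≤ r → coeff z (r ∸ i) ≡ coeff z i) → p ≈ completion r q
completion-unique r p q z deg e pal i with 2 * i <? r
... | no ¬lt = trans (deg i (≮⇒≥ ¬lt)) (sym (completion-high r q i (≮⇒≥ ¬lt)))
... | yes lt = begin
    coeff p i                                             ≡⟨ x+y-y _ (coeff q i) ⟨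
    coeff p i ℤ.+ coeff q i ℤ.- coeff q i                 ≡⟨ cong (ℤ._- coeff q i) (e i) ⟨
    coeff z i ℤ.- coeff q i                               ≡⟨ cong (ℤ._- coeff q i) (pal i (≤-trans (m≤m+n i _) (<⇒≤ lt))) ⟨
    coeff z (r ∸ i) ℤ.- coeff q i                         ≡⟨ cong (ℤ._- coeff q i) (e (r ∸ i)) ⟩
    coeff p (r ∸ i) ℤ.+ coeff q (r ∸ i) ℤ.- coeff q i     ≡⟨ cong (λ x → x ℤ.+ coeff q (r ∸ i) ℤ.- coeff q i) (deg (r ∸ i) (complement-high {i = i} (<⇒≤ lt))) ⟩
    ℤ.0ℤ ℤ.+ coeff q (r ∸ i) ℤ.- coeff q i                ≡⟨ cong (ℤ._- coeff q i) (ℤ.+-identityˡ (coeff q (r ∸ i))) ⟩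
    coeff q (r ∸ i) ℤ.- coeff q i                         ≡⟨ completion-low r q i lt ⟨
    coeff (completion r q) i                              ∎
  where open ≡-Reasoning

flatTerm-cong : ∀ (P Q : Assignment) {N} (M M′ : Matroid N) → M ≋ M′ → ∀ F →
  (∀ (h : F ⊆ ground M) (h′ : F ⊆ ground M′) → P (contract M F h) ≈ Q (contract M′ F h′)) →
  flatTerm P M F ≈ flatTerm Q M′ F
flatTerm-cong P Q M M′ eq F e i with isFlat? M F | isFlat? M′ F
... | yes f       | no ¬f       = contradiction (≋-flat M M′ eq F f) ¬f
... | no ¬f       | yes f       = contradiction (≋-flat M′ M (≋-sym M M′ eq) F f) ¬f
... | no _        | no _        = refl
... | yes (h , _) | yes (h′ , _) rewrite proj₂ eq F h = t^-cong (rank M′ F) (e h h′) i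

properSum-cong : ∀ (P Q : Assignment) {N} (M M′ : Matroid N) → M ≋ M′ →
  (∀ F → F ≢ ⊥ → ∀ (h : F ⊆ ground M) (h′ : F ⊆ ground M′) → P (contract M F h) ≈ Q (contract M′ F h′)) →
  properSum P M ≈ properSum Q M′
properSum-cong P Q {N} M M′ eq e = sum-cong N _ _ term
  where
  term : ∀ F → properTerm P M F ≈ properTerm Q M′ F
  term F i with ≡-dec Bool._≟_ F ⊥
  ... | yes _   = refl
  ... | no F≢⊥ = flatTerm-cong P Q M M′ eq F (e F F≢⊥) i

properSum-bound : ∀ (P : Assignment) →
  (∀ {N} (M : Matroid N) i → rk M < i → coeff (P M) i ≡ ℤ.0ℤ) →
  ∀ {N} (M : Matroid N) i → rk M < i → coeff (properSum P M) i ≡ ℤ.0ℤ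
properSum-bound P b {N} M = sum-bound N term
  where
  term : ∀ F i → rk M < i → coeff (properTerm P M F) i ≡ ℤ.0ℤ
  term F i r<i with ≡-dec Bool._≟_ F ⊥
  ... | yes _ = refl
  ... | no _ with isFlat? M F
  ...   | no _ = refl
  ...   | yes (h , _) = t^-bound (rank M F) (b (contract M F h)) i
            (subst (_< i) (sym (trans (cong (rank M F +_) (rk-contract M F h))
                                      (m+[n∸m]≡n (rank-mono M F (ground M) h id)))) r<i)

kazhdanLusztig-unique : ∀ (P Q : Assignment) → IsKazhdanLusztig P → IsKazhdanLusztig Q →
                        ∀ {N} (M : Matroid N) → P M ≈ Q M
kazhdanLusztig-unique P Q p q M = go (suc (rk M)) M ≤-refl
  where
  open IsKazhdanLusztig

  solve : ∀ (P : Assignment) → IsKazhdanLusztig P → ∀ {N} (M : Matroid N) → Loopless M →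
          0 < rk M → P M ≈ completion (rk M) (properSum P M)
  solve P p M ll r>0 = completion-unique (rk M) (P M) (properSum P M) (Z P M)
    (degree p M ll r>0) (Z-split P (respects-≋ p) M ll) (proj₁ (palindromic p M ll))

  go : ∀ k {N} (M : Matroid N) → rk M < k → P M ≈ Q M
  go (suc k) M (s≤s r≤k) i with loopless? M
  ... | no ¬ll = trans (loops p M ¬ll i) (sym (loops q M ¬ll i))
  ... | yes ll with rk M ≟ 0
  ...   | yes r≡0 = trans (rank-zero p M ll r≡0 i) (sym (rank-zero q M ll r≡0 i))
  ...   | no  r≢0 = trans (solve P p M ll (n≢0⇒n>0 r≢0) i) (trans
    (completion-cong {rk M} (properSum P M) (properSum Q M) refl (properSum-cong P Q M M (≋-refl M) λ F F≢⊥ h h′ j →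
      trans (respects-≋ p _ _ (≋-contract M M (≋-refl M) F h h′) j)
            (go k (contract M F h′) (<-≤-trans (rk-contract-< M ll F h′ F≢⊥) r≤k) j)) i)
    (sym (solve Q q M ll (n≢0⇒n>0 r≢0) i)))

-- The first argument is fuel; any value above the rank gives P_M.
kl : ℕ → Assignment
kl zero    M = []
kl (suc k) M with loopless? M
... | no _ = []
... | yes _ with rk M ≟ 0
...   | yes _ = ℤ.1ℤ ∷ []
...   | no _  = completion (rk M) (properSum (kl k) M)

kl-cong : ∀ k k′ {N} (M M′ : Matroid N) → M ≋ M′ → rk M < k → rk M′ < k′ → kl k M ≈ kl k′ M′
kl-cong (suc k) (suc k′) M M′ eq (s≤s r≤k) (s≤s r′≤k′) i with loopless? M | loopless? M′
... | no _   | no _    = refl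
... | yes ll | no ¬ll  = contradiction (≋-loopless M M′ eq ll) ¬ll
... | no ¬ll | yes ll  = contradiction (≋-loopless M′ M (≋-sym M M′ eq) ll) ¬ll
... | yes ll | yes ll′ with rk M ≟ 0 | rk M′ ≟ 0
...   | yes _  | yes _  = refl
...   | yes e  | no ¬e  = contradiction (trans (sym (≋-rk M M′ eq)) e) ¬e
...   | no ¬e  | yes e  = contradiction (trans (≋-rk M M′ eq) e) ¬e
...   | no _   | no _   = completion-cong (properSum (kl k) M) (properSum (kl k′) M′) (≋-rk M M′ eq)
  (properSum-cong (kl k) (kl k′) M M′ eq λ F F≢⊥ h h′ →
    kl-cong k k′ _ _ (≋-contract M M′ eq F h h′)
      (<-≤-trans (rk-contract-< M ll F h F≢⊥) r≤k)
      (<-≤-trans (rk-contract-< M′ ll′ F h′ F≢⊥) r′≤k′)) i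

kazhdanLusztig : Assignment
kazhdanLusztig M = kl (suc (rk M)) M

kazhdanLusztig-isKazhdanLusztig : IsKazhdanLusztig kazhdanLusztig
kazhdanLusztig-isKazhdanLusztig = record
  { respects-≋  = KL-resp
  ; rank-zero   = zero-case
  ; degree      = λ M ll r>0 i r≤2i → trans (positive-case M ll r>0 i) (completion-high (rk M) _ i r≤2i)
  ; palindromic = λ M ll → pal M ll , λ i r<i →
      trans (Z-split KL KL-resp M ll i) (cong₂ ℤ._+_ (bound M i r<i) (properSum-bound KL bound M i r<i))
  ; loops       = loop-case
  }
  where
  KL : Assignment
  KL = kazhdanLusztig

  KL-resp : ∀ {N} (M M′ : Matroid N) → M ≋ M′ → KL M ≈ KL M′
  KL-resp M M′ eq = kl-cong _ _ M M′ eq ≤-refl ≤-refl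

  loop-case : ∀ {N} (M : Matroid N) → ¬ Loopless M → KL M ≈ []
  loop-case M ¬ll i with loopless? M
  ... | no _   = refl
  ... | yes ll = contradiction ll ¬ll

  zero-case : ∀ {N} (M : Matroid N) → Loopless M → rk M ≡ 0 → KL M ≈ ℤ.1ℤ ∷ []
  zero-case M ll r≡0 i with loopless? M
  ... | no ¬ll = contradiction ll ¬ll
  ... | yes _ with rk M ≟ 0
  ...   | yes _  = refl
  ...   | no r≢0 = contradiction r≡0 r≢0

  positive-case : ∀ {N} (M : Matroid N) → Loopless M → 0 < rk M →
                  KL M ≈ completion (rk M) (properSum KL M)
  positive-case M ll r>0 i with loopless? M
  ... | no ¬ll = contradiction ll ¬ll
  ... | yes _ with rk M ≟ 0
  ...   | yes r≡0 = contradiction (sym r≡0) (<⇒≢ r>0)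
  ...   | no _ = completion-cong {rk M} (properSum (kl (rk M)) M) (properSum KL M) refl (properSum-cong (kl (rk M)) KL M M (≋-refl M) λ F F≢⊥ h h′ →
    kl-cong (rk M) _ _ _ (≋-contract M M (≋-refl M) F h h′) (rk-contract-< M ll F h F≢⊥) ≤-refl) i

  bound : ∀ {N} (M : Matroid N) i → rk M < i → coeff (KL M) i ≡ ℤ.0ℤ
  bound M i r<i with loopless? M in eq
  ... | no _ = refl
  ... | yes _ with rk M ≟ 0
  bound M (suc i) r<i | yes _ | yes _ = refl
  bound M i       r<i | yes _ | no _  = completion-high (rk M) _ i (≤-trans (<⇒≤ r<i) (m≤m+n i _))

  pal : ∀ {N} (M : Matroid N) → Loopless M → ∀ i → i ≤ rk M → coeff (Z KL M) (rk M ∸ i) ≡ coeff (Z KL M) i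
  pal M ll i i≤r with rk M in eq
  ... | zero rewrite n≤0⇒n≡0 i≤r = refl
  ... | suc r = completion-palindromic (suc r) (properSum KL M) (Z KL M) (λ j →
    trans (Z-split KL KL-resp M ll j) (cong (ℤ._+ coeff (properSum KL M) j)
      (trans (positive-case M ll (subst (0 <_) (sym eq) (s≤s z≤n)) j)
             (cong (λ x → coeff (completion x (properSum KL M)) j) eq)))) i i≤r

{-# OPTIONS --safe #-}
module Submission where

-- Let M have corank 2, and let ρ be the rank function of the dual, so that
-- the sets of rank 1 are the parallel classes.  For S ⊆ E write n = ∣ S ∣.
-- If ρ S = 1 then M/(E ─ S) is the circuit U_{n-1,n}, and t P = R_n, the
-- generating function of Riordan paths of length n by down steps.  In
-- general t^(ρ S) P_{M/(E ─ S)} is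
--
--   R_n + Σ_{a+b=n-1} d(a,b) - Σ_{x ∈ S} d(a_x, n-1-a_x),
--   d(a,b) = t (R_{a+b} - V_a R_b),
--
-- where V counts Motzkin paths and a_x is the number of later elements of S
-- parallel to x.  The degree bounds are visible from the paths.  Adding the
-- weight t to all level steps is the binomial transform, which is what
-- summation over flats does; it turns R into t times Narayana polynomials Γ
-- and d(a,b+1) into t² (Γ_{a+b} - Γ_a Γ_b), which are palindromic.  By
-- uniqueness these are the Kazhdan-Lusztig polynomials.  Hence Z_U - Z_M is
-- the sum over x ∈ E of Γ_{a+b} - Γ_a Γ_b with a = a_x and a + b = n - 2,
-- and this counts paths from 0 to 0 that do not return to 0 after a steps.

open import Data.Bool.Base using (Bool; true; false; if_then_else_)
import Data.Bool.Properties as Bool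
open import Data.Empty using (⊥-elim)
open import Data.Fin.Base using (Fin; zero; suc)
open import Data.Fin.Properties using (_≟_; ¬∀⟶∃¬)
open import Data.Fin.Subset
open import Data.Fin.Subset.Properties
open import Data.Integer.Base using (ℤ; 0ℤ; 1ℤ; +≤+; _≤_) renaming (_+_ to _+ᶻ_; _-_ to _-ᶻ_)
import Data.Integer.Properties as ℤ
open import Data.Integer.Tactic.RingSolver using (solve-∀)
open import Data.List.Base using ([]; _∷_)
open import Data.Nat.Base renaming (_≤_ to _≤ⁿ_)
open import Data.Nat.Properties hiding (_≟_)
import Data.Nat.Properties as ℕ
import Data.Nat.Tactic.RingSolver as ℕ-Ring
open import Data.Product.Base using (_×_; _,_; proj₁; proj₂; ∃)
open import Data.Sum.Base using (inj₁; inj₂; [_,_]′)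
open import Data.Vec.Base using ([]; _∷_; lookup; here; there; tabulate)
open import Data.Vec.Properties using (lookup∘tabulate; []=⇒lookup; lookup⇒[]=; ≡-dec)
open import Function.Base using (_∘_; id)
open import Relation.Binary.PropositionalEquality
open import Relation.Nullary using (contradiction; yes; no; does; ¬_; ¬?; Dec; _×-dec_)
open import Relation.Nullary.Decidable using (dec-true; dec-false; decidable-stable)
open import Algebra.Properties.AbelianGroup ℤ.+-0-abelianGroup using (∙-cancelʳ)
open import Defs hiding (_≋_; _≈_)

-- The factor t^(ρ S) is what turns the sum over flats into a binomial transform: rk F + ρ E = ∣ F ∣
-- + ρ (E ─ F), so the term of F in t^(ρ E) Z_M carries the weight t^∣ F ∣, whatever M is. The sum
-- may run over all subsets because the closed formula vanishes if E ─ S is not a flat, that is, if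
-- ρ has a coloop on S. The source of this vanishing is R_{n+1} = t (V_n - R_n), which says R_{n+1}
-- + d(n,0) = 0.
--
-- Counting only later parallel elements makes a_x run through 0, ..., c-1 once on each parallel
-- class of size c. If S is a single class, the two sums of defects therefore cancel, and one
-- formula serves ranks 1 and 2. In rank 2 every x has b > 0 in its defect, and only then is the
-- transformed defect palindromic and nonnegative; the single term d(n-1,0) of the first sum is
-- absorbed by R_n. In the uniform case every a_x is 0 and d(0,b) = 0, so exactly the subtracted sum
-- separates Z_M from Z_U.

-- Power series and the relations preserved by addition and shift

Series : Set
Series = ℕ → ℤ

0ˢ : Series
0ˢ _ = 0ℤ

1ˢ : Series
1ˢ zero    = 1ℤ
1ˢ (suc _) = 0ℤ

infixl 6 _+ˢ_ _-ˢ_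
_+ˢ_ _-ˢ_ : Series → Series → Series
(f +ˢ g) i = f i +ᶻ g i
(f -ˢ g) i = f i -ᶻ g i

-- Multiplication by t.
↑ : Series → Series
↑ f zero    = 0ℤ
↑ f (suc i) = f i

infix 4 _≼_
_≼_ : Series → Series → Set
f ≼ g = ∀ i → f i ≤ g i

-- Every operator below is built from addition and multiplication by t, so
-- it preserves these relations; linearity, congruence and monotonicity are
-- all instances.
record Compatible (Q : Series → Series → Series → Set) : Set where
  field
    zero-closed : Q 0ˢ 0ˢ 0ˢ
    +-closed    : ∀ {f g h f′ g′ h′} → Q f g h → Q f′ g′ h′ → Q (f +ˢ f′) (g +ˢ g′) (h +ˢ h′)
    ↑-closed    : ∀ {f g h} → Q f g h → Q (↑ f) (↑ g) (↑ h)

open Compatible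

IsSum IsDifference IsShift Congruent Below : Series → Series → Series → Set
IsSum        f g h = f +ˢ g ≗ h
IsDifference f g h = f -ˢ g ≗ h
IsShift      f _ h = ↑ f ≗ h
Congruent    f g _ = f ≗ g
Below        f g _ = f ≼ g

private
  interchange-+ : ∀ a b c d → (a +ᶻ b) +ᶻ (c +ᶻ d) ≡ (a +ᶻ c) +ᶻ (b +ᶻ d)
  interchange-+ = solve-∀

  interchange-- : ∀ a b c d → (a +ᶻ b) -ᶻ (c +ᶻ d) ≡ (a -ᶻ c) +ᶻ (b -ᶻ d)
  interchange-- = solve-∀

sum-compatible : Compatible IsSum
sum-compatible .zero-closed i = refl
sum-compatible .+-closed {f} {g} {_} {f′} {g′} p q i =
  trans (interchange-+ (f i) (f′ i) (g i) (g′ i)) (cong₂ _+ᶻ_ (p i) (q i))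
sum-compatible .↑-closed p zero    = refl
sum-compatible .↑-closed p (suc i) = p i

difference-compatible : Compatible IsDifference
difference-compatible .zero-closed i = refl
difference-compatible .+-closed {f} {g} {_} {f′} {g′} p q i =
  trans (interchange-- (f i) (f′ i) (g i) (g′ i)) (cong₂ _+ᶻ_ (p i) (q i))
difference-compatible .↑-closed p zero    = refl
difference-compatible .↑-closed p (suc i) = p i

shift-compatible : Compatible IsShift
shift-compatible .zero-closed zero    = refl
shift-compatible .zero-closed (suc i) = refl
shift-compatible .+-closed p q zero    = cong₂ _+ᶻ_ (p 0) (q 0)
shift-compatible .+-closed p q (suc i) = cong₂ _+ᶻ_ (p (suc i)) (q (suc i))
shift-compatible .↑-closed p zero    = refl
shift-compatible .↑-closed p (suc i) = p i

congruent-compatible : Compatible Congruent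
congruent-compatible .zero-closed i = refl
congruent-compatible .+-closed p q i = cong₂ _+ᶻ_ (p i) (q i)
congruent-compatible .↑-closed p zero    = refl
congruent-compatible .↑-closed p (suc i) = p i

below-compatible : Compatible Below
below-compatible .zero-closed i = ℤ.≤-refl
below-compatible .+-closed p q i = ℤ.+-mono-≤ (p i) (q i)
below-compatible .↑-closed p zero    = ℤ.≤-refl
below-compatible .↑-closed p (suc i) = p i

↑-cong : ∀ {f g} → f ≗ g → ↑ f ≗ ↑ g
↑-cong = ↑-closed congruent-compatible {h = 0ˢ}

+-cong : ∀ {f g f′ g′} → f ≗ g → f′ ≗ g′ → f +ˢ f′ ≗ g +ˢ g′
+-cong p q i = cong₂ _+ᶻ_ (p i) (q i)

-cong : ∀ {f g f′ g′} → f ≗ g → f′ ≗ g′ → f -ˢ f′ ≗ g -ˢ g′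
-cong p q i = cong₂ _-ᶻ_ (p i) (q i)

-- Weighted lattice paths

-- A family of series indexed by the height of the endpoint of a path.
Heights : Set
Heights = ℕ → Series

-- Append one step: up steps and level steps have weight 1, down steps have
-- weight t.  Riordan paths have no level steps at height 0.
riordan motzkin : Heights → Heights
riordan u zero    = ↑ (u 1)
riordan u (suc k) = u (suc k) +ˢ u k +ˢ ↑ (u (2 + k))
motzkin u zero    = u 0 +ˢ ↑ (u 1)
motzkin u (suc k) = u (suc k) +ˢ u k +ˢ ↑ (u (2 + k))

-- Level steps of weight t are added at every height.
tilted : (Heights → Heights) → Heights → Heights
tilted S u k = ↑ (u k) +ˢ S u k

iter : (Heights → Heights) → ℕ → Heights → Heights
iter S zero    u = u
iter S (suc n) u = iter S n (S u)

-- Starting with weight f at height 0 multiplies all path counts from 0 by f. A product such as V_a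
-- R_b thus arises by running Riordan steps from V_a, and series are never multiplied.
start : Series → Heights
start f zero    = f
start f (suc k) = 0ˢ

iter-suc : ∀ S n u → iter S (suc n) u ≡ S (iter S n u)
iter-suc S zero    u = refl
iter-suc S (suc n) u = iter-suc S n (S u)

iter-+ : ∀ S m n u → iter S (m + n) u ≡ iter S n (iter S m u)
iter-+ S zero    n u = refl
iter-+ S (suc m) n u = iter-+ S m n (S u)

module _ {Q} (c : Compatible Q) where

  Heightwise : Heights → Heights → Heights → Set
  Heightwise u v w = ∀ k → Q (u k) (v k) (w k)

  Preserves : (Heights → Heights) → Set
  Preserves S = ∀ u v w → Heightwise u v w → Heightwise (S u) (S v) (S w)

  riordan-preserves : Preserves riordan
  riordan-preserves _ _ _ p zero    = ↑-closed c (p 1)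
  riordan-preserves _ _ _ p (suc k) = +-closed c (+-closed c (p (suc k)) (p k)) (↑-closed c (p (2 + k)))

  motzkin-preserves : Preserves motzkin
  motzkin-preserves _ _ _ p zero    = +-closed c (p 0) (↑-closed c (p 1))
  motzkin-preserves _ _ _ p (suc k) = +-closed c (+-closed c (p (suc k)) (p k)) (↑-closed c (p (2 + k)))

  tilted-preserves : ∀ {S} → Preserves S → Preserves (tilted S)
  tilted-preserves s u v w p k = +-closed c (↑-closed c (p k)) (s u v w p k)

  iter-preserves : ∀ {S} → Preserves S → ∀ n → Preserves (iter S n)
  iter-preserves s zero    u v w p = p
  iter-preserves {S} s (suc n) u v w p = iter-preserves s n (S u) (S v) (S w) (s u v w p)

  start-preserves : ∀ {f g h} → Q f g h → Heightwise (start f) (start g) (start h)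
  start-preserves q zero    = q
  start-preserves q (suc k) = zero-closed c

Natural : (Heights → Heights) → Set₁
Natural S = ∀ {Q} (c : Compatible Q) → Preserves c S

adjacent : Heights → Heights
adjacent u k = u k +ˢ u (suc k)

_≋ʰ_ : Heights → Heights → Set
u ≋ʰ v = ∀ k → u k ≗ v k

iter-cong : ∀ {S} → Natural S → ∀ n {u v} → u ≋ʰ v → iter S n u ≋ʰ iter S n v
iter-cong s n {u} {v} = iter-preserves congruent-compatible (s congruent-compatible) n u v u

-- Let (U u) k = u (k-1), with value 0 at k = 0, let (D u) k = u (k+1), and let A = 1 + D, which is
-- `adjacent`. As D U = 1, the two steps factor as `riordan` = U A + t D and `motzkin` = A U + t D,
-- and A commutes with D.
motzkin-adjacent : ∀ u → motzkin (adjacent u) ≋ʰ adjacent (riordan u)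
motzkin-adjacent u zero    zero    = lem (u 0 0) (u 1 0)
  where
  lem : ∀ a b → a +ᶻ b +ᶻ 0ℤ ≡ 0ℤ +ᶻ (b +ᶻ a +ᶻ 0ℤ)
  lem = solve-∀
motzkin-adjacent u zero    (suc i) = lem (u 0 (suc i)) (u 1 (suc i)) (u 1 i) (u 2 i)
  where
  lem : ∀ a b c d → a +ᶻ b +ᶻ (c +ᶻ d) ≡ c +ᶻ (b +ᶻ a +ᶻ d)
  lem = solve-∀
motzkin-adjacent u (suc k) zero    = lem (u k 0) (u (1 + k) 0) (u (2 + k) 0)
  where
  lem : ∀ a b c → b +ᶻ c +ᶻ (a +ᶻ b) +ᶻ 0ℤ ≡ b +ᶻ a +ᶻ 0ℤ +ᶻ (c +ᶻ b +ᶻ 0ℤ)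
  lem = solve-∀
motzkin-adjacent u (suc k) (suc i) =
  lem (u k (suc i)) (u (1 + k) (suc i)) (u (2 + k) (suc i)) (u (2 + k) i) (u (3 + k) i)
  where
  lem : ∀ a b c d e → b +ᶻ c +ᶻ (a +ᶻ b) +ᶻ (d +ᶻ e) ≡ b +ᶻ a +ᶻ d +ᶻ (c +ᶻ b +ᶻ e)
  lem = solve-∀

tilted-adjacent : ∀ u → tilted motzkin (adjacent u) ≋ʰ adjacent (tilted riordan u)
tilted-adjacent u k zero    = trans (cong (0ℤ +ᶻ_) (motzkin-adjacent u k 0))
  (lem (riordan u k 0) (riordan u (suc k) 0))
  where
  lem : ∀ a b → 0ℤ +ᶻ (a +ᶻ b) ≡ (0ℤ +ᶻ a) +ᶻ (0ℤ +ᶻ b)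
  lem = solve-∀
tilted-adjacent u k (suc i) = trans (cong ((u k i +ᶻ u (suc k) i) +ᶻ_) (motzkin-adjacent u k (suc i)))
  (interchange-+ (u k i) (u (suc k) i) (riordan u k (suc i)) _)

iter-adjacent : ∀ {S S′} → Natural S′ → (∀ u → S′ (adjacent u) ≋ʰ adjacent (S u)) →
                ∀ n u → iter S′ n (adjacent u) ≋ʰ adjacent (iter S n u)
iter-adjacent nat e zero    u k i = refl
iter-adjacent {S} nat e (suc n) u k i =
  trans (iter-cong nat n (e u) k i) (iter-adjacent nat e n (S u) k i)

adjacent-start : ∀ f → adjacent (start f) ≋ʰ start f
adjacent-start f zero    i = ℤ.+-identityʳ (f i)
adjacent-start f (suc k) i = refl

riordan-natural : Natural riordan
riordan-natural c = riordan-preserves c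

motzkin-natural : Natural motzkin
motzkin-natural c = motzkin-preserves c

tilted-natural : ∀ {S} → Natural S → Natural (tilted S)
tilted-natural s c = tilted-preserves c (s c)

-- The last step comes down from height 1. As `adjacent` fixes `start f`, the Motzkin count at
-- height 0 is the sum of the Riordan counts at heights 0 and 1, and subtraction isolates the
-- latter.
riordan-return : ∀ n f → iter riordan (suc n) (start f) 0 ≗
                 ↑ (iter motzkin n (start f) 0) -ˢ ↑ (iter riordan n (start f) 0)
riordan-return n f zero    = cong (λ u → u 0 0) (iter-suc riordan n (start f))
riordan-return n f (suc i) = begin
  iter riordan (suc n) (start f) 0 (suc i)    ≡⟨ cong (λ u → u 0 (suc i)) (iter-suc riordan n (start f)) ⟩
  r 1 i                                       ≡⟨ lem (r 0 i) (r 1 i) ⟩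
  r 0 i +ᶻ r 1 i -ᶻ r 0 i                     ≡⟨ cong (_-ᶻ r 0 i) (iter-adjacent motzkin-natural motzkin-adjacent n (start f) 0 i) ⟨
  iter motzkin n (adjacent (start f)) 0 i -ᶻ r 0 i ≡⟨ cong (_-ᶻ r 0 i) (iter-cong motzkin-natural n (adjacent-start f) 0 i) ⟩
  iter motzkin n (start f) 0 i -ᶻ r 0 i       ∎
  where
  open ≡-Reasoning
  r = iter riordan n (start f)
  lem : ∀ a b → b ≡ a +ᶻ b -ᶻ a
  lem = solve-∀

-- The last step is a down step or the new level step at height 0. Both have weight t, so the counts
-- at heights 0 and 1 enter only through their sum, a single Motzkin count.
tilted-return : ∀ n f → iter (tilted riordan) (suc n) (start f) 0 ≗
                ↑ (iter (tilted motzkin) n (start f) 0)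
tilted-return n f zero    = cong (λ u → u 0 0) (iter-suc (tilted riordan) n (start f))
tilted-return n f (suc i) = begin
  iter (tilted riordan) (suc n) (start f) 0 (suc i) ≡⟨ cong (λ u → u 0 (suc i)) (iter-suc (tilted riordan) n (start f)) ⟩
  adjacent (iter (tilted riordan) n (start f)) 0 i  ≡⟨ iter-adjacent (tilted-natural motzkin-natural) tilted-adjacent n (start f) 0 i ⟨
  iter (tilted motzkin) n (adjacent (start f)) 0 i  ≡⟨ iter-cong (tilted-natural motzkin-natural) n (adjacent-start f) 0 i ⟩
  iter (tilted motzkin) n (start f) 0 i             ∎
  where open ≡-Reasoning

-- Degrees and palindromes

-- 2 deg f ≤ n - k.
Low : ℕ → ℕ → Series → Set
Low k n f = ∀ i → n < 2 * i + k → f i ≡ 0ℤ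

-- f is palindromic of degree n - k, hence 0 if this is negative.
Pal : ℕ → ℕ → Series → Set
Pal k n f = (∀ i j → i + j + k ≡ n → f i ≡ f j) × (∀ i → n < i + k → f i ≡ 0ℤ)

Low-+ : ∀ {k n f g} → Low k n f → Low k n g → Low k n (f +ˢ g)
Low-+ p q i lt = cong₂ _+ᶻ_ (p i lt) (q i lt)

Low-- : ∀ {k n f g} → Low k n f → Low k n g → Low k n (f -ˢ g)
Low-- p q i lt = cong₂ _-ᶻ_ (p i lt) (q i lt)

Low-↑ : ∀ {k n f} → Low k n f → Low k (2 + n) (↑ f)
Low-↑ p zero    lt = refl
Low-↑ {k} {n} p (suc i) lt = p i (+-cancelˡ-< 2 n (2 * i + k) (subst (2 + n <_) (cong (_+ k) (*-suc 2 i)) lt))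

Low-weaken : ∀ {k n f} → Low k n f → Low k (suc n) f
Low-weaken p i lt = p i (<-trans (n<1+n _) lt)

Low-suc : ∀ {k n f} → Low k n f → Low (suc k) (suc n) f
Low-suc {k} {n} p i lt = p i (s<s⁻¹ (subst (suc n <_) (+-suc (2 * i) k) lt))

Low-pred : ∀ {k n f} → Low (suc k) (suc n) f → Low k n f
Low-pred {k} {n} p i lt = p i (subst (suc n <_) (sym (+-suc (2 * i) k)) (s<s lt))

-- Here n plays the role of the length: a path of length n to height k has at most (n - k) / 2 down
-- steps, and only these carry t.
LowHeights : ℕ → Heights → Set
LowHeights n u = ∀ k → Low k n (u k)

start-low : ∀ {n f} → Low 0 n f → LowHeights n (start f)
start-low p zero    = p
start-low p (suc k) i lt = refl

riordan-low : ∀ {n u} → LowHeights n u → LowHeights (suc n) (riordan u)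
riordan-low p zero    = Low-pred (Low-↑ (p 1))
riordan-low p (suc k) = Low-+ (Low-+ (Low-weaken (p (suc k))) (Low-suc (p k))) (Low-pred (Low-↑ (p (2 + k))))

motzkin-low : ∀ {n u} → LowHeights n u → LowHeights (suc n) (motzkin u)
motzkin-low p zero    = Low-+ (Low-weaken (p 0)) (Low-pred (Low-↑ (p 1)))
motzkin-low p (suc k) = Low-+ (Low-+ (Low-weaken (p (suc k))) (Low-suc (p k))) (Low-pred (Low-↑ (p (2 + k))))

iter-low : ∀ {S} → (∀ {n u} → LowHeights n u → LowHeights (suc n) (S u)) →
           ∀ m {n u} → LowHeights n u → LowHeights (m + n) (iter S m u)
iter-low s zero    p = p
iter-low {S} s (suc m) {n} {u} p = subst (λ x → LowHeights x (iter S m (S u))) (+-suc m n) (iter-low s m (s p))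

Pal-+ : ∀ {k n f g} → Pal k n f → Pal k n g → Pal k n (f +ˢ g)
Pal-+ (p , p′) (q , q′) = (λ i j e → cong₂ _+ᶻ_ (p i j e) (q i j e)) , λ i lt → cong₂ _+ᶻ_ (p′ i lt) (q′ i lt)

Pal-- : ∀ {k n f g} → Pal k n f → Pal k n g → Pal k n (f -ˢ g)
Pal-- (p , p′) (q , q′) = (λ i j e → cong₂ _-ᶻ_ (p i j e) (q i j e)) , λ i lt → cong₂ _-ᶻ_ (p′ i lt) (q′ i lt)

Pal-cong : ∀ {k n f g} → f ≗ g → Pal k n f → Pal k n g
Pal-cong e (p , p′) = (λ i j q → trans (sym (e i)) (trans (p i j q) (e j))) , λ i lt → trans (sym (e i)) (p′ i lt)

Pal-suc : ∀ {k n f} → Pal k n f → Pal (suc k) (suc n) f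
Pal-suc {k} {n} (p , p′) =
  (λ i j e → p i j (suc-injective (trans (sym (+-suc (i + j) k)) e))) ,
  λ i lt → p′ i (s<s⁻¹ (subst (suc n <_) (+-suc i k) lt))

Pal-pred : ∀ {k n f} → Pal (suc k) (suc n) f → Pal k n f
Pal-pred {k} {n} (p , p′) =
  (λ i j e → p i j (trans (+-suc (i + j) k) (cong suc e))) ,
  λ i lt → p′ i (subst (suc n <_) (sym (+-suc i k)) (s<s lt))

private
  Pal-neighbour : ∀ {k n f} → Pal k n f → ∀ i j → i + j + k ≡ suc n → ↑ f i ≡ f j
  Pal-neighbour (p , p′) zero    j e = sym (p′ j (≤-reflexive (sym e)))
  Pal-neighbour (p , p′) (suc i) j e = p i j (suc-injective e)

Pal-↑ : ∀ {k n f} → Pal k n f → Pal k (2 + n) (↑ f)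
Pal-↑ {k} {n} {f} pal@(p , p′) = mirror , high
  where
  mirror : ∀ i j → i + j + k ≡ 2 + n → ↑ f i ≡ ↑ f j
  mirror zero    zero    e = refl
  mirror i       (suc j) e = Pal-neighbour pal i j (suc-injective (trans (cong (_+ k) (sym (+-suc i j))) e))
  mirror (suc i) zero    e = sym (Pal-neighbour pal 0 i (trans (cong (_+ k) (sym (+-identityʳ i))) (suc-injective e)))
  high : ∀ i → 2 + n < i + k → ↑ f i ≡ 0ℤ
  high zero    lt = refl
  high (suc i) lt = p′ i (<-trans (n<1+n n) (s<s⁻¹ lt))

-- The coefficient at i is f_{i-1} + f_i, and reflection exchanges the two summands.
Pal-1+t : ∀ {k n f} → Pal k n f → Pal k (suc n) (↑ f +ˢ f)
Pal-1+t {k} {n} {f} pal@(p , p′) = mirror , high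
  where
  mirror : ∀ i j → i + j + k ≡ suc n → ↑ f i +ᶻ f i ≡ ↑ f j +ᶻ f j
  mirror i j e = trans (cong₂ _+ᶻ_ (Pal-neighbour pal i j e)
    (sym (Pal-neighbour pal j i (trans (cong (_+ k) (+-comm j i)) e)))) (ℤ.+-comm (f j) _)
  high : ∀ i → suc n < i + k → ↑ f i +ᶻ f i ≡ 0ℤ
  high zero    lt = cong (0ℤ +ᶻ_) (p′ 0 (<-trans (n<1+n n) lt))
  high (suc i) lt = cong₂ _+ᶻ_ (p′ i (s<s⁻¹ lt)) (p′ (suc i) (<-trans (n<1+n n) lt))

PalHeights : ℕ → Heights → Set
PalHeights n u = ∀ k → Pal k n (u k)

start-pal : ∀ {n f} → Pal 0 n f → PalHeights n (start f)
start-pal p zero    = p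
start-pal p (suc k) = (λ _ _ _ → refl) , λ _ _ → refl

-- A path with d down steps and l level steps has weight t^d (1+t)^l, symmetric under i + j = 2d +
-- l; this is n - k for length n and final height k.
tilted-motzkin-pal : ∀ {n u} → PalHeights n u → PalHeights (suc n) (tilted motzkin u)
tilted-motzkin-pal {u = u} p zero    = Pal-cong (λ i → ℤ.+-assoc (↑ (u 0) i) (u 0 i) (↑ (u 1) i))
  (Pal-+ (Pal-1+t (p 0)) (Pal-pred (Pal-↑ (p 1))))
tilted-motzkin-pal {u = u} p (suc k) = Pal-cong
  (λ i → lem (↑ (u (suc k)) i) (u (suc k) i) (u k i) (↑ (u (2 + k)) i))
  (Pal-+ (Pal-+ (Pal-1+t (p (suc k))) (Pal-suc (p k))) (Pal-pred (Pal-↑ (p (2 + k)))))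
  where
  lem : ∀ a b c d → a +ᶻ b +ᶻ c +ᶻ d ≡ a +ᶻ (b +ᶻ c +ᶻ d)
  lem = solve-∀

iter-pal : ∀ m {n u} → PalHeights n u → PalHeights (m + n) (iter (tilted motzkin) m u)
iter-pal zero    p = p
iter-pal (suc m) {n} {u} p =
  subst (λ x → PalHeights x (iter (tilted motzkin) m (tilted motzkin u))) (+-suc m n)
    (iter-pal m (tilted-motzkin-pal p))

-- Binomial transforms and summation operators

-- Σₖ (n choose k) t^(n-k) φ k
binomial : ℕ → (ℕ → Series) → Series
binomial zero    φ = φ 0
binomial (suc n) φ = ↑ (binomial n φ) +ˢ binomial n (φ ∘ suc)

binomial₂ : ℕ → ℕ → (ℕ → ℕ → Series) → Series
binomial₂ zero    b φ = binomial b (φ 0)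
binomial₂ (suc a) b φ = ↑ (binomial₂ a b φ) +ˢ binomial₂ a b (φ ∘ suc)

-- The sum of φ a b over a + b + 1 ≡ n.
antidiagonal : (ℕ → ℕ → Series) → ℕ → Series
antidiagonal φ zero    = 0ˢ
antidiagonal φ (suc n) = φ n 0 +ˢ antidiagonal (λ a b → φ a (suc b)) n

sumFin : ∀ {N} → (Fin N → Series) → Series
sumFin {zero}  f = 0ˢ
sumFin {suc N} f = f zero +ˢ sumFin (f ∘ suc)

when : Bool → Series → Series
when b f = if b then f else 0ˢ

-- The sum of t^∣E ─ S∣ g S over S ⊆ E.
overSubsets : ∀ {N} → Subset N → (Subset N → Series) → Series
overSubsets []            g = g []
overSubsets (outside ∷ E) g = overSubsets E (g ∘ (outside ∷_))
overSubsets (inside  ∷ E) g = ↑ (overSubsets E (g ∘ (outside ∷_))) +ˢ overSubsets E (g ∘ (inside ∷_))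

module _ {Q} (c : Compatible Q) where

  binomial-preserves : ∀ n {φ ψ χ} → (∀ m → Q (φ m) (ψ m) (χ m)) →
                       Q (binomial n φ) (binomial n ψ) (binomial n χ)
  binomial-preserves zero    p = p 0
  binomial-preserves (suc n) p =
    +-closed c (↑-closed c (binomial-preserves n p)) (binomial-preserves n (p ∘ suc))

  binomial₂-preserves : ∀ a b {φ ψ χ} → (∀ i j → Q (φ i j) (ψ i j) (χ i j)) →
                        Q (binomial₂ a b φ) (binomial₂ a b ψ) (binomial₂ a b χ)
  binomial₂-preserves zero    b p = binomial-preserves b (p 0)
  binomial₂-preserves (suc a) b p =
    +-closed c (↑-closed c (binomial₂-preserves a b p)) (binomial₂-preserves a b (p ∘ suc))

  antidiagonal-preserves : ∀ n {φ ψ χ} → (∀ a b → Q (φ a b) (ψ a b) (χ a b)) →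
                           Q (antidiagonal φ n) (antidiagonal ψ n) (antidiagonal χ n)
  antidiagonal-preserves zero    p = zero-closed c
  antidiagonal-preserves (suc n) p =
    +-closed c (p n 0) (antidiagonal-preserves n λ a b → p a (suc b))

  sumFin-preserves : ∀ {N} {f g h : Fin N → Series} → (∀ x → Q (f x) (g x) (h x)) →
                     Q (sumFin f) (sumFin g) (sumFin h)
  sumFin-preserves {zero}  p = zero-closed c
  sumFin-preserves {suc N} p = +-closed c (p zero) (sumFin-preserves (p ∘ suc))

  overSubsets-preserves : ∀ {N} (E : Subset N) {f g h} → (∀ S → Q (f S) (g S) (h S)) →
                          Q (overSubsets E f) (overSubsets E g) (overSubsets E h)
  overSubsets-preserves []            p = p []
  overSubsets-preserves (outside ∷ E) p = overSubsets-preserves E (p ∘ (outside ∷_))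
  overSubsets-preserves (inside  ∷ E) p =
    +-closed c (↑-closed c (overSubsets-preserves E (p ∘ (outside ∷_))))
               (overSubsets-preserves E (p ∘ (inside ∷_)))

binomial₂-zeroʳ : ∀ a φ → binomial₂ a 0 φ ≗ binomial a (λ i → φ i 0)
binomial₂-zeroʳ zero    φ i = refl
binomial₂-zeroʳ (suc a) φ = +-cong (↑-cong (binomial₂-zeroʳ a φ)) (binomial₂-zeroʳ a (φ ∘ suc))

binomial₂-sucʳ : ∀ a b φ → binomial₂ a (suc b) φ ≗
                 ↑ (binomial₂ a b φ) +ˢ binomial₂ a b (λ i j → φ i (suc j))
binomial₂-sucʳ zero    b φ i = refl
binomial₂-sucʳ (suc a) b φ i =
  trans (+-cong (↑-cong (binomial₂-sucʳ a b φ)) (binomial₂-sucʳ a b (φ ∘ suc)) i) (swap i)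
  where
  φ⁺ : ℕ → ℕ → Series
  φ⁺ i j = φ i (suc j)
  swap : ↑ (↑ (binomial₂ a b φ) +ˢ binomial₂ a b φ⁺) +ˢ (↑ (binomial₂ a b (φ ∘ suc)) +ˢ binomial₂ a b (φ⁺ ∘ suc))
       ≗ ↑ (↑ (binomial₂ a b φ) +ˢ binomial₂ a b (φ ∘ suc)) +ˢ (↑ (binomial₂ a b φ⁺) +ˢ binomial₂ a b (φ⁺ ∘ suc))
  swap zero    = refl
  swap (suc i) = interchange-+ (↑ (binomial₂ a b φ) i) (binomial₂ a b φ⁺ i) (binomial₂ a b (φ ∘ suc) i) _

-- Double counting of subsets of an n-element chain with a marked element, where φ sees the numbers
-- of chosen elements on its two sides: either the subset or the marked element is chosen first.
binomial-antidiagonal : ∀ n φ → binomial n (antidiagonal φ) ≗ antidiagonal (λ a b → binomial₂ a b φ) n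
binomial-antidiagonal zero    φ i = refl
binomial-antidiagonal (suc n) φ i = begin
  ↑ (binomial n (antidiagonal φ)) i +ᶻ binomial n (λ m → φ m 0 +ˢ antidiagonal φ⁺ m) i
    ≡⟨ cong₂ _+ᶻ_ (↑-cong (binomial-antidiagonal n φ) i)
        (sym (binomial-preserves sum-compatible n {λ m → φ m 0} {antidiagonal φ⁺} (λ _ _ → refl) i)) ⟩
  ↑ (antidiagonal β n) i +ᶻ (binomial n (λ m → φ m 0) i +ᶻ binomial n (antidiagonal φ⁺) i)
    ≡⟨ cong₂ _+ᶻ_ (antidiagonal-preserves shift-compatible n {β} {β} {λ a b → ↑ (β a b)} (λ _ _ _ → refl) i)
         (cong₂ _+ᶻ_ (sym (binomial₂-zeroʳ n φ i)) (binomial-antidiagonal n φ⁺ i)) ⟩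
  antidiagonal (λ a b → ↑ (β a b)) n i +ᶻ (β n 0 i +ᶻ antidiagonal β⁺ n i)
    ≡⟨ lem (antidiagonal (λ a b → ↑ (β a b)) n i) (β n 0 i) (antidiagonal β⁺ n i) ⟩
  β n 0 i +ᶻ (antidiagonal (λ a b → ↑ (β a b)) n i +ᶻ antidiagonal β⁺ n i)
    ≡⟨ cong (β n 0 i +ᶻ_) (antidiagonal-preserves sum-compatible n {λ a b → ↑ (β a b)} {β⁺}
         {λ a b → β a (suc b)} (λ a b i → sym (binomial₂-sucʳ a b φ i)) i) ⟩
  β n 0 i +ᶻ antidiagonal (λ a b → β a (suc b)) n i ∎
  where
  open ≡-Reasoning
  φ⁺ β β⁺ : ℕ → ℕ → Series
  φ⁺ a b = φ a (suc b)
  β a b = binomial₂ a b φ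
  β⁺ a b = binomial₂ a b φ⁺
  lem : ∀ x y z → x +ᶻ (y +ᶻ z) ≡ y +ᶻ (x +ᶻ z)
  lem = solve-∀

-- Subset sums

overSubsets-card : ∀ {N} (E : Subset N) φ → overSubsets E (λ S → φ ∣ S ∣) ≗ binomial ∣ E ∣ φ
overSubsets-card []            φ i = refl
overSubsets-card (outside ∷ E) φ = overSubsets-card E φ
overSubsets-card (inside  ∷ E) φ = +-cong (↑-cong (overSubsets-card E φ)) (overSubsets-card E (φ ∘ suc))

overSubsets-card₂ : ∀ {N} (E A : Subset N) φ →
  overSubsets E (λ S → φ ∣ A ∩ S ∣ ∣ ∁ A ∩ S ∣) ≗ binomial₂ ∣ A ∩ E ∣ ∣ ∁ A ∩ E ∣ φ
overSubsets-card₂ []            []            φ i = refl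
overSubsets-card₂ (outside ∷ E) (outside ∷ A) φ = overSubsets-card₂ E A φ
overSubsets-card₂ (outside ∷ E) (inside  ∷ A) φ = overSubsets-card₂ E A φ
overSubsets-card₂ (inside  ∷ E) (outside ∷ A) φ i =
  trans (+-cong (↑-cong (overSubsets-card₂ E A φ)) (overSubsets-card₂ E A (λ a b → φ a (suc b))) i)
        (sym (binomial₂-sucʳ ∣ A ∩ E ∣ ∣ ∁ A ∩ E ∣ φ i))
overSubsets-card₂ (inside  ∷ E) (inside  ∷ A) φ =
  +-cong (↑-cong (overSubsets-card₂ E A φ)) (overSubsets-card₂ E A (φ ∘ suc))

overSubsets-zero : ∀ {N} (E : Subset N) → overSubsets E (λ _ → 0ˢ) ≗ 0ˢ
overSubsets-zero []            i       = refl
overSubsets-zero (outside ∷ E) i       = overSubsets-zero E i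
overSubsets-zero (inside  ∷ E) zero    = cong (0ℤ +ᶻ_) (overSubsets-zero E 0)
overSubsets-zero (inside  ∷ E) (suc i) = cong₂ _+ᶻ_ (overSubsets-zero E i) (overSubsets-zero E (suc i))

rest : ∀ {N} → Fin N → Subset N → Subset N
rest x A = ∁ (⁅ x ⁆ ∪ A)

split : ∀ {N} → (ℕ → ℕ → Series) → Fin N → Subset N → Subset N → Series
split φ x A S = when (lookup S x) (φ ∣ A ∩ S ∣ ∣ rest x A ∩ S ∣)

↑-when : ∀ b f → ↑ (when b f) ≗ when b (↑ f)
↑-when true  f i       = refl
↑-when false f zero    = refl
↑-when false f (suc i) = refl

when-+ : ∀ b f g → when b f +ˢ when b g ≗ when b (f +ˢ g)
when-+ true  f g i = refl
when-+ false f g i = refl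

when-cong : ∀ b {f g} → f ≗ g → when b f ≗ when b g
when-cong true  e i = e i
when-cong false e i = refl

-- A set S that contains x consists of x, a part of A and a part of `rest x A`, chosen
-- independently.
overSubsets-split : ∀ {N} (E : Subset N) x A → x ∉ A → ∀ φ →
  overSubsets E (split φ x A) ≗ split (λ a b → binomial₂ a b φ) x A E
overSubsets-split (e ∷ E) zero (inside ∷ A) x∉A φ i = contradiction here x∉A
overSubsets-split (outside ∷ E) zero (outside ∷ A) x∉A φ i = overSubsets-zero E i
overSubsets-split (inside ∷ E) zero (outside ∷ A) x∉A φ i rewrite ∪-identityˡ A =
  trans (cong₂ _+ᶻ_ (↑-zero (overSubsets-zero E) i) (overSubsets-card₂ E A φ i)) (ℤ.+-identityˡ _)
  where
  ↑-zero : ∀ {f} → f ≗ 0ˢ → ↑ f ≗ 0ˢ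
  ↑-zero e zero    = refl
  ↑-zero e (suc i) = e i
overSubsets-split (outside ∷ E) (suc x) (outside ∷ A) x∉A φ =
  overSubsets-split E x A (drop-not-there x∉A) φ
overSubsets-split (outside ∷ E) (suc x) (inside ∷ A) x∉A φ =
  overSubsets-split E x A (drop-not-there x∉A) φ
overSubsets-split (inside ∷ E) (suc x) (outside ∷ A) x∉A φ i = begin
  ↑ (overSubsets E (split φ x A)) i +ᶻ overSubsets E (split φ⁺ x A) i
    ≡⟨ +-cong (↑-cong (overSubsets-split E x A x∉A′ φ)) (overSubsets-split E x A x∉A′ φ⁺) i ⟩
  ↑ (when (lookup E x) (β φ)) i +ᶻ when (lookup E x) (β φ⁺) i
    ≡⟨ cong (_+ᶻ when (lookup E x) (β φ⁺) i) (↑-when (lookup E x) (β φ) i) ⟩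
  when (lookup E x) (↑ (β φ)) i +ᶻ when (lookup E x) (β φ⁺) i
    ≡⟨ when-+ (lookup E x) (↑ (β φ)) (β φ⁺) i ⟩
  when (lookup E x) (↑ (β φ) +ˢ β φ⁺) i
    ≡⟨ when-cong (lookup E x) (binomial₂-sucʳ ∣ A ∩ E ∣ ∣ rest x A ∩ E ∣ φ) i ⟨
  when (lookup E x) (binomial₂ ∣ A ∩ E ∣ (suc ∣ rest x A ∩ E ∣) φ) i ∎
  where
  open ≡-Reasoning
  x∉A′ = drop-not-there x∉A
  φ⁺ : ℕ → ℕ → Series
  φ⁺ a b = φ a (suc b)
  β : (ℕ → ℕ → Series) → Series
  β = binomial₂ ∣ A ∩ E ∣ ∣ rest x A ∩ E ∣
overSubsets-split (inside ∷ E) (suc x) (inside ∷ A) x∉A φ i =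
  trans (+-cong (↑-cong (overSubsets-split E x A x∉A′ φ)) (overSubsets-split E x A x∉A′ (φ ∘ suc)) i)
 (trans (cong (_+ᶻ when (lookup E x) (β (φ ∘ suc)) i) (↑-when (lookup E x) (β φ) i))
        (when-+ (lookup E x) (↑ (β φ)) (β (φ ∘ suc)) i))
  where
  x∉A′ = drop-not-there x∉A
  β : (ℕ → ℕ → Series) → Series
  β = binomial₂ ∣ A ∩ E ∣ ∣ rest x A ∩ E ∣

-- The common shape of the formulas for P and for Z. The sets A x do not depend on S, so the sum
-- over S can be evaluated for each x separately.
total : ∀ {N} → (ℕ → Series) → (ℕ → ℕ → Series) → (Fin N → Subset N) → Subset N → Series
total q φ A S = (q ∣ S ∣ +ˢ antidiagonal φ ∣ S ∣) -ˢ sumFin (λ x → split φ x (A x) S)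

sumFin-cong : ∀ {N} {f g : Fin N → Series} → (∀ x → f x ≗ g x) → sumFin f ≗ sumFin g
sumFin-cong {f = f} = sumFin-preserves congruent-compatible {h = f}

overSubsets-sumFin : ∀ {N M} (E : Subset N) (f : Fin M → Subset N → Series) →
  overSubsets E (λ S → sumFin (λ x → f x S)) ≗ sumFin (λ x → overSubsets E (f x))
overSubsets-sumFin {M = zero}  E f = overSubsets-zero E
overSubsets-sumFin {M = suc M} E f i = trans
  (sym (overSubsets-preserves sum-compatible E {f zero} {λ S → sumFin (λ x → f (suc x) S)} (λ _ _ → refl) i))
  (cong (overSubsets E (f zero) i +ᶻ_) (overSubsets-sumFin E (f ∘ suc) i))

overSubsets-total : ∀ {N} (E : Subset N) q φ A → (∀ x → x ∉ A x) →
  overSubsets E (total q φ A) ≗ total (λ n → binomial n q) (λ a b → binomial₂ a b φ) A E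
overSubsets-total E q φ A x∉A i = begin
  overSubsets E (total q φ A) i
    ≡⟨ overSubsets-preserves difference-compatible E {λ S → q ∣ S ∣ +ˢ antidiagonal φ ∣ S ∣} {σ} (λ _ _ → refl) i ⟨
  overSubsets E (λ S → q ∣ S ∣ +ˢ antidiagonal φ ∣ S ∣) i -ᶻ overSubsets E σ i
    ≡⟨ cong (_-ᶻ overSubsets E σ i) (overSubsets-preserves sum-compatible E
         {λ S → q ∣ S ∣} {λ S → antidiagonal φ ∣ S ∣} (λ _ _ → refl) i) ⟨
  overSubsets E (λ S → q ∣ S ∣) i +ᶻ overSubsets E (λ S → antidiagonal φ ∣ S ∣) i -ᶻ overSubsets E σ i
    ≡⟨ cong₂ _-ᶻ_ (cong₂ _+ᶻ_ (overSubsets-card E q i)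
         (trans (overSubsets-card E (antidiagonal φ) i) (binomial-antidiagonal ∣ E ∣ φ i)))
         (trans (overSubsets-sumFin E (λ x → split φ x (A x)) i)
                (sumFin-cong (λ x → overSubsets-split E x (A x) (x∉A x) φ) i)) ⟩
  total (λ n → binomial n q) (λ a b → binomial₂ a b φ) A E i ∎
  where
  open ≡-Reasoning
  σ : Subset _ → Series
  σ S = sumFin (λ x → split φ x (A x) S)

-- Binomial transforms of path counts

δ : Heights
δ = start 1ˢ

iter-tilted : ∀ {S} → Natural S → ∀ n u k →
              iter (tilted S) n (tilted S u) k ≗ ↑ (iter (tilted S) n u k) +ˢ iter (tilted S) n (S u) k
iter-tilted {S} s n u k i = sym (trans
  (cong (_+ᶻ iter (tilted S) n (S u) k i)
    (iter-preserves shift-compatible (tilted-natural s shift-compatible) n u u (λ k → ↑ (u k)) (λ _ _ → refl) k i))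
  (iter-preserves sum-compatible (tilted-natural s sum-compatible) n (λ k → ↑ (u k)) (S u) _ (λ _ _ → refl) k i))

-- The binomial theorem for the operator t + S, valid because naturality makes S commute with
-- multiplication by t.
binomial-iter : ∀ {S} → Natural S → ∀ n u k →
                binomial n (λ m → iter S m u k) ≗ iter (tilted S) n u k
binomial-iter s zero    u k i = refl
binomial-iter {S} s (suc n) u k i = trans
  (+-cong (↑-cong (binomial-iter s n u k)) (binomial-iter s n (S u) k) i)
  (sym (iter-tilted s n u k i))

binomial₂-iter-+ : ∀ {S} → Natural S → ∀ a b u k →
                   binomial₂ a b (λ i j → iter S (i + j) u k) ≗ iter (tilted S) (a + b) u k
binomial₂-iter-+ s zero    b u k = binomial-iter s b u k
binomial₂-iter-+ {S} s (suc a) b u k i = trans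
  (+-cong (↑-cong (binomial₂-iter-+ s a b u k)) (binomial₂-iter-+ s a b (S u) k) i)
  (sym (iter-tilted s (a + b) u k i))

start-cong : ∀ {f g} → f ≗ g → start f ≋ʰ start g
start-cong {f} = start-preserves congruent-compatible {h = f}

-- The first path enters only as initial weight of the second, on which the outcome depends
-- linearly; so the transforms in the two variables act on the two factors of a product.
binomial₂-iter-start : ∀ {S S′} → Natural S → Natural S′ → ∀ a b u k →
  binomial₂ a b (λ i j → iter S j (start (iter S′ i u 0)) k) ≗
  iter (tilted S) b (start (iter (tilted S′) a u 0)) k
binomial₂-iter-start s s′ zero    b u k = binomial-iter s b (start (u 0)) k
binomial₂-iter-start {S} {S′} s s′ (suc a) b u k i = begin
  ↑ (binomial₂ a b (λ i j → iter S j (start (iter S′ i u 0)) k)) i +ᶻ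
    binomial₂ a b (λ i j → iter S j (start (iter S′ i (S′ u) 0)) k) i
    ≡⟨ +-cong (↑-cong (binomial₂-iter-start s s′ a b u k)) (binomial₂-iter-start s s′ a b (S′ u) k) i ⟩
  ↑ (T (iter T′ a u 0) k) i +ᶻ T (iter T′ a (S′ u) 0) k i
    ≡⟨ cong (_+ᶻ T (iter T′ a (S′ u) 0) k i) (preserves shift-compatible (iter T′ a u 0) 0ˢ _ (λ _ → refl) i) ⟩
  T (↑ (iter T′ a u 0)) k i +ᶻ T (iter T′ a (S′ u) 0) k i
    ≡⟨ preserves sum-compatible (↑ (iter T′ a u 0)) (iter T′ a (S′ u) 0) _ (λ _ → refl) i ⟩
  T (↑ (iter T′ a u 0) +ˢ iter T′ a (S′ u) 0) k i
    ≡⟨ iter-cong (tilted-natural s) b (start-cong (iter-tilted s′ a u 0)) k i ⟨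
  T (iter T′ a (T′ u) 0) k i ∎
  where
  open ≡-Reasoning
  T′ : Heights → Heights
  T′ = tilted S′
  T : Series → Heights
  T f = iter (tilted S) b (start f)
  preserves : ∀ {Q} (c : Compatible Q) f g h → Q f g h → Q (T f k) (T g k) (T h k)
  preserves c f g h q =
    iter-preserves c (tilted-natural s c) b (start f) (start g) (start h) (start-preserves c q) k

-- Defects, circuits and Narayana polynomials

-- t times the weight of the paths of length a + b from 0 to 0 with steps S,
-- minus that of concatenations of an S′-path of length a and an S-path of
-- length b, both from 0 to 0.
defect : (S S′ : Heights → Heights) → ℕ → ℕ → Series
defect S S′ a b = ↑ (iter S (a + b) δ 0 -ˢ iter S b (start (iter S′ a δ 0)) 0)

binomial₂-defect : ∀ {S S′} → Natural S → Natural S′ → ∀ a b →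
                   binomial₂ a b (defect S S′) ≗ defect (tilted S) (tilted S′) a b
binomial₂-defect {S} {S′} s s′ a b i = begin
  binomial₂ a b (defect S S′) i
    ≡⟨ binomial₂-preserves shift-compatible a b {λ i j → f i j -ˢ g i j} {f} (λ _ _ _ → refl) i ⟨
  ↑ (binomial₂ a b (λ i j → f i j -ˢ g i j)) i
    ≡⟨ ↑-cong (λ i → sym (binomial₂-preserves difference-compatible a b {f} {g} (λ _ _ _ → refl) i)) i ⟩
  ↑ (binomial₂ a b f -ˢ binomial₂ a b g) i
    ≡⟨ ↑-cong (-cong (binomial₂-iter-+ s a b δ 0) (binomial₂-iter-start s s′ a b δ 0)) i ⟩
  defect (tilted S) (tilted S′) a b i ∎
  where
  open ≡-Reasoning
  f g : ℕ → ℕ → Series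
  f i j = iter S (i + j) δ 0
  g i j = iter S j (start (iter S′ i δ 0)) 0

-- For n > 0, t times the Kazhdan–Lusztig polynomial of U_{n-1,n}.
circuit : ℕ → Series
circuit n = iter riordan n δ 0

-- For n > 0, t times the Z-polynomial of U_{n-1,n}.
circuitZ : ℕ → Series
circuitZ n = iter (tilted riordan) n δ 0

-- For n > 0, the Z-polynomial of U_{n,n+1}, whose coefficients are Narayana numbers.
narayana : ℕ → Series
narayana n = iter (tilted motzkin) n δ 0

localDefect globalDefect : ℕ → ℕ → Series
localDefect  = defect riordan motzkin
globalDefect = defect (tilted riordan) (tilted motzkin)

-- An empty second path leaves d(n,0) = t (R_n - V_n), the negative of what `riordan-return` gives
-- for R_{n+1}.
circuit-cancels : ∀ n → circuit (suc n) +ˢ localDefect n 0 ≗ 0ˢ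
circuit-cancels n zero    = cong (_+ᶻ 0ℤ) (riordan-return n 1ˢ 0)
circuit-cancels n (suc i) rewrite riordan-return n 1ˢ (suc i) | +-identityʳ n =
  lem (iter motzkin n δ 0 i) (iter riordan n δ 0 i)
  where
  lem : ∀ a b → a -ᶻ b +ᶻ (b -ᶻ a) ≡ 0ℤ
  lem = solve-∀

-- In rank 2, `circuitZ (suc n)` alone would be centred half a degree too low. For n > 0 the
-- remainder `↑ (circuitZ n)` has the right centre.
circuitZ-cancels : ∀ n → circuitZ (suc n) +ˢ globalDefect n 0 ≗ ↑ (circuitZ n)
circuitZ-cancels n zero    = cong (_+ᶻ 0ℤ) (tilted-return n 1ˢ 0)
circuitZ-cancels n (suc i) rewrite tilted-return n 1ˢ (suc i) | +-identityʳ n =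
  lem (iter (tilted motzkin) n δ 0 i) (iter (tilted riordan) n δ 0 i)
  where
  lem : ∀ a b → a +ᶻ (b -ᶻ a) ≡ b
  lem = solve-∀

defect-zeroˡ : ∀ S S′ b → defect S S′ 0 b ≗ 0ˢ
defect-zeroˡ S S′ b zero    = refl
defect-zeroˡ S S′ b (suc i) = ℤ.+-inverseʳ (iter S b δ 0 i)

-- Degrees and symmetry of the path counts

δ-low : LowHeights 0 δ
δ-low = start-low λ { (suc i) _ → refl }

δ-pal : PalHeights 0 δ
δ-pal = start-pal ((λ { zero zero _ → refl ; zero (suc j) () ; (suc i) _ () }) , λ { (suc i) _ → refl })

circuit-low : ∀ n → Low 0 n (circuit n)
circuit-low n = subst (λ m → Low 0 m (circuit n)) (+-identityʳ n) (iter-low riordan-low n δ-low 0)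

localDefect-low : ∀ a b → Low 0 (2 + (a + b)) (localDefect a b)
localDefect-low a b = Low-↑ (Low-- (circuit-low (a + b))
  (subst (λ m → Low 0 m (iter riordan b (start (iter motzkin a δ 0)) 0)) (+-comm b a)
    (iter-low riordan-low b (start-low (subst (λ m → Low 0 m (iter motzkin a δ 0)) (+-identityʳ a)
      (iter-low motzkin-low a δ-low 0))) 0)))

narayana-pal : ∀ n → Pal 0 n (narayana n)
narayana-pal n = subst (λ m → Pal 0 m (narayana n)) (+-identityʳ n) (iter-pal n δ-pal 0)

circuitZ-pal : ∀ n → Pal 0 (2 + n) (circuitZ (suc n))
circuitZ-pal n = Pal-cong (λ i → sym (tilted-return n 1ˢ i)) (Pal-↑ (narayana-pal n))

-- A second path of positive length makes both terms end with a return to 0, so `tilted-return`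
-- extracts another factor t and leaves Motzkin paths only.
globalDefect-suc : ∀ a b → globalDefect a (suc b) ≗
  ↑ (↑ (narayana (a + b) -ˢ iter (tilted motzkin) b (start (narayana a)) 0))
globalDefect-suc a b zero    = refl
globalDefect-suc a b (suc i) rewrite +-suc a b | tilted-return (a + b) 1ˢ i | tilted-return b (narayana a) i = lem i
  where
  lem : ∀ {f g} i → ↑ f i -ᶻ ↑ g i ≡ ↑ (f -ˢ g) i
  lem zero    = refl
  lem (suc i) = refl

globalDefect-pal : ∀ a b → Pal 0 (4 + (a + b)) (globalDefect a (suc b))
globalDefect-pal a b = Pal-cong (λ i → sym (globalDefect-suc a b i)) (Pal-↑ (Pal-↑ (Pal-- (narayana-pal (a + b))
  (subst (λ m → Pal 0 m (iter (tilted motzkin) b (start (narayana a)) 0)) (+-comm b a)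
    (iter-pal b (start-pal (narayana-pal a)) 0)))))

-- Nonnegativity

tilted-motzkin-natural : Natural (tilted motzkin)
tilted-motzkin-natural = tilted-natural motzkin-natural

iter-nonneg : ∀ n u → (∀ k → 0ˢ ≼ u k) → ∀ k → 0ˢ ≼ iter (tilted motzkin) n u k
iter-nonneg zero    u p = p
iter-nonneg (suc n) u p = iter-nonneg n (tilted motzkin u) λ k i →
  subst (_≤ tilted motzkin u k i) (zeros k i)
    (tilted-motzkin-natural below-compatible (λ _ → 0ˢ) u u p k i)
  where
  zeros : ∀ k → tilted motzkin (λ _ → 0ˢ) k ≗ 0ˢ
  zeros zero    zero    = refl
  zeros zero    (suc i) = refl
  zeros (suc k) zero    = refl
  zeros (suc k) (suc i) = refl

δ-nonneg : ∀ k → 0ˢ ≼ δ k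
δ-nonneg zero    zero    = +≤+ z≤n
δ-nonneg zero    (suc i) = ℤ.≤-refl
δ-nonneg (suc k) i       = ℤ.≤-refl

narayana-nonneg : ∀ n → 0ˢ ≼ narayana n
narayana-nonneg n = iter-nonneg n δ δ-nonneg 0

↑-nonneg : ∀ {f} → 0ˢ ≼ f → 0ˢ ≼ ↑ f
↑-nonneg p zero    = ℤ.≤-refl
↑-nonneg p (suc i) = p i

-- Concatenated paths are among all paths.
globalDefect-nonneg : ∀ a b → 0ˢ ≼ globalDefect a (suc b)
globalDefect-nonneg a b i = subst (0ℤ ≤_) (sym (globalDefect-suc a b i)) (↑-nonneg (↑-nonneg difference) i)
  where
  Γ = iter (tilted motzkin)
  below : ∀ k → start (narayana a) k ≼ Γ a δ k
  below zero    i = ℤ.≤-refl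
  below (suc k) i = iter-nonneg a δ δ-nonneg (suc k) i
  difference : 0ˢ ≼ narayana (a + b) -ˢ Γ b (start (narayana a)) 0
  difference i = ℤ.i≤j⇒0≤j-i (subst (Γ b (start (narayana a)) 0 i ≤_)
    (cong (λ u → u 0 i) (sym (iter-+ (tilted motzkin) a b δ)))
    (iter-preserves below-compatible (tilted-motzkin-natural below-compatible) b
      (start (narayana a)) (Γ a δ) (Γ a δ) below 0 i))

-- Splitting sums according to later related elements

later : ∀ {N} → (Fin N → Fin N → Bool) → Fin N → Subset N
later r zero    = outside ∷ tabulate (r zero ∘ suc)
later r (suc x) = outside ∷ later (λ y z → r (suc y) (suc z)) x

x∉later : ∀ {N} (r : Fin N → Fin N → Bool) x → x ∉ later r x
x∉later r zero    ()
x∉later r (suc x) (there x∈) = x∉later _ x x∈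

all : ∀ {N} → Fin N → Fin N → Bool
all _ _ = true

later⁻ : ∀ {N} (r : Fin N → Fin N → Bool) x {y} → y ∈ later r x → r x y ≡ true × y ∈ later all x
later⁻ r zero    {suc y} (there y∈) =
  trans (sym (lookup∘tabulate (r zero ∘ suc) y)) ([]=⇒lookup y∈) ,
  there (lookup⇒[]= y _ (lookup∘tabulate (λ _ → true) y))
later⁻ r (suc x) {suc y} (there y∈) =
  let e , l = later⁻ (λ y z → r (suc y) (suc z)) x y∈ in e , there l

later⁺ : ∀ {N} (r : Fin N → Fin N → Bool) x {y} → r x y ≡ true → y ∈ later all x → y ∈ later r x
later⁺ r zero    {suc y} e (there _)  = there (lookup⇒[]= y _ (trans (lookup∘tabulate (r zero ∘ suc) y) e))
later⁺ r (suc x) {suc y} e (there y∈) = there (later⁺ (λ y z → r (suc y) (suc z)) x e y∈)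

later-restrict : ∀ {N} (r : Fin N → Fin N → Bool) x S S′ → S′ ⊆ S →
  (∀ y → y ∈ S′ → r x y ≡ true) → (∀ y → y ∈ S → y ∉ S′ → r x y ≡ false) →
  later r x ∩ S ≡ later all x ∩ S′
later-restrict r x S S′ S′⊆S related unrelated = ⊆-antisym to from
  where
  to : later r x ∩ S ⊆ later all x ∩ S′
  to {y} y∈ with x∈p∩q⁻ (later r x) S y∈
  ... | y∈l , y∈S with later⁻ r x y∈l | y ∈? S′
  ...   | _ , y∈a | yes y∈S′ = x∈p∩q⁺ (y∈a , y∈S′)
  ...   | e , _   | no  y∉S′ = contradiction (trans (sym e) (unrelated y y∈S y∉S′)) λ ()
  from : later all x ∩ S′ ⊆ later r x ∩ S
  from {y} y∈ = let y∈a , y∈S′ = x∈p∩q⁻ (later all x) S′ y∈ in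
    x∈p∩q⁺ (later⁺ r x (related y y∈S′) y∈a , S′⊆S y∈S′)

card-∁ : ∀ {N} (A S : Subset N) → ∣ A ∩ S ∣ + ∣ ∁ A ∩ S ∣ ≡ ∣ S ∣
card-∁ []            []            = refl
card-∁ (inside  ∷ A) (inside  ∷ S) = cong suc (card-∁ A S)
card-∁ (inside  ∷ A) (outside ∷ S) = card-∁ A S
card-∁ (outside ∷ A) (inside  ∷ S) = trans (+-suc ∣ A ∩ S ∣ _) (cong suc (card-∁ A S))
card-∁ (outside ∷ A) (outside ∷ S) = card-∁ A S

card-rest : ∀ {N} x (A S : Subset N) → x ∉ A → x ∈ S → suc (∣ A ∩ S ∣ + ∣ rest x A ∩ S ∣) ≡ ∣ S ∣
card-rest zero    (inside  ∷ A) _             x∉A _          = contradiction here x∉A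
card-rest zero    (outside ∷ A) (inside  ∷ S) x∉A here rewrite ∪-identityˡ A = cong suc (card-∁ A S)
card-rest (suc x) (inside  ∷ A) (inside  ∷ S) x∉A (there x∈) = cong suc (card-rest x A S (drop-not-there x∉A) x∈)
card-rest (suc x) (inside  ∷ A) (outside ∷ S) x∉A (there x∈) = card-rest x A S (drop-not-there x∉A) x∈
card-rest (suc x) (outside ∷ A) (inside  ∷ S) x∉A (there x∈) =
  cong suc (trans (+-suc ∣ A ∩ S ∣ _) (card-rest x A S (drop-not-there x∉A) x∈))
card-rest (suc x) (outside ∷ A) (outside ∷ S) x∉A (there x∈) = card-rest x A S (drop-not-there x∉A) x∈

split-inside : ∀ {N} φ x (A S : Subset N) → x ∈ S → split φ x A S ≡ φ ∣ A ∩ S ∣ ∣ rest x A ∩ S ∣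
split-inside φ x A S x∈ rewrite []=⇒lookup x∈ = refl

split-outside : ∀ {N} φ x (A S : Subset N) → x ∉ S → split φ x A S ≡ 0ˢ
split-outside φ x A S x∉ with lookup S x in eq
... | true  = contradiction (lookup⇒[]= x S eq) x∉
... | false = refl

-- The element with a later elements in S has ∣ S ∣ - 1 - a earlier ones, so each pair on the
-- antidiagonal occurs once.
sumFin-later-all : ∀ {N} φ (S : Subset N) → sumFin (λ x → split φ x (later all x) S) ≗ antidiagonal φ ∣ S ∣
sumFin-later-all φ []            i = refl
sumFin-later-all φ (outside ∷ S) i =
  trans (ℤ.+-identityˡ _) (sumFin-later-all φ S i)
sumFin-later-all {suc N} φ (inside ∷ S) i =
  cong₂ _+ᶻ_ (cong₂ (λ a b → φ a b i) above below) (sumFin-later-all (λ a b → φ a (suc b)) S i)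
  where
  full : tabulate (λ (_ : Fin N) → true) ≡ ⊤
  full = ⊆-antisym (⊆-max _) λ {x} _ → lookup⇒[]= x _ (lookup∘tabulate (λ _ → true) x)
  above : ∣ tabulate (λ (_ : Fin N) → true) ∩ S ∣ ≡ ∣ S ∣
  above = cong ∣_∣ (trans (cong (_∩ S) full) (∩-identityˡ S))
  below : ∣ ∁ (⊥ ∪ tabulate (λ (_ : Fin N) → true)) ∩ S ∣ ≡ 0
  below = +-cancelˡ-≡ ∣ S ∣ _ 0 (trans (cong₂ _+_ (sym above) (cong (λ X → ∣ ∁ X ∩ S ∣) (∪-identityˡ _)))
    (trans (card-∁ (tabulate (λ _ → true)) S) (sym (+-identityʳ ∣ S ∣))))

total-all : ∀ {N} q φ (r : Fin N → Fin N → Bool) S → (∀ x y → x ∈ S → y ∈ S → r x y ≡ true) →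
            total q φ (later r) S ≗ q ∣ S ∣
total-all q φ r S related i =
  trans (cong (λ y → x -ᶻ y) (trans (sumFin-cong agree i) (sumFin-later-all φ S i)))
        (lem (q ∣ S ∣ i) (antidiagonal φ ∣ S ∣ i))
  where
  x = (q ∣ S ∣ +ˢ antidiagonal φ (∣ S ∣)) i
  lem : ∀ a b → a +ᶻ b -ᶻ b ≡ a
  lem = solve-∀
  agree : ∀ x → split φ x (later r x) S ≗ split φ x (later all x) S
  agree x i with x ∈? S
  ... | no x∉S  = cong (λ f → f i) (trans (split-outside φ x (later r x) S x∉S)
                                            (sym (split-outside φ x (later all x) S x∉S)))
  ... | yes x∈S rewrite split-inside φ x (later r x) S x∈S | split-inside φ x (later all x) S x∈S =
    cong₂ (λ a b → φ a b i) (cong ∣_∣ above) (+-cancelˡ-≡ ∣ later all x ∩ S ∣ _ _ (suc-injective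
      (trans (cong (λ X → suc (∣ X ∣ + ∣ rest x (later r x) ∩ S ∣)) (sym above))
        (trans (card-rest x (later r x) S (x∉later r x) x∈S)
        (sym (card-rest x (later all x) S (x∉later all x) x∈S))))))
    where
    above : later r x ∩ S ≡ later all x ∩ S
    above = later-restrict r x S S id (λ y → related x y x∈S) λ y y∈ y∉ → contradiction y∈ y∉

card-─ : ∀ {N} (S A : Subset N) → A ⊆ S → ∣ A ∣ + ∣ S ─ A ∣ ≡ ∣ S ∣
card-─ []            []            A⊆S = refl
card-─ (inside  ∷ S) (inside  ∷ A) A⊆S = cong suc (card-─ S A (drop-∷-⊆ A⊆S))
card-─ (inside  ∷ S) (outside ∷ A) A⊆S = trans (+-suc ∣ A ∣ _) (cong suc (card-─ S A (drop-∷-⊆ A⊆S)))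
card-─ (outside ∷ S) (outside ∷ A) A⊆S = card-─ S A (drop-∷-⊆ A⊆S)
card-─ (outside ∷ S) (inside  ∷ A) A⊆S with () ← A⊆S here

x∈p─q⁻ : ∀ {N} (p q : Subset N) {x} → x ∈ p ─ q → x ∈ p × x ∉ q
x∈p─q⁻ p q x∈ = p─q⊆p p q x∈ , disjoint p q x∈
  where
  disjoint : ∀ {N} (p q : Subset N) {x} → x ∈ p ─ q → x ∉ q
  disjoint (_ ∷ p) (_      ∷ q) (there x∈) (there x∈q) = disjoint p q x∈ x∈q
  disjoint (_ ∷ p) (inside ∷ q) () here

⁅x⁆⊆ : ∀ {N} {S : Subset N} {x} → x ∈ S → ⁅ x ⁆ ⊆ S
⁅x⁆⊆ {x = x} x∈S y∈ rewrite x∈⁅y⁆⇒x≡y x y∈ = x∈S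

card-remove : ∀ {N} (S : Subset N) x → x ∈ S → ∣ S ∣ ≡ suc ∣ S ─ ⁅ x ⁆ ∣
card-remove S x x∈S = trans (sym (card-─ S ⁅ x ⁆ (⁅x⁆⊆ x∈S))) (cong (_+ ∣ S ─ ⁅ x ⁆ ∣) (∣⁅x⁆∣≡1 x))

-- The element z contributes d(0,b) = 0, and being unrelated it raises b by one for every other x.
-- With n = ∣ S ∣ - 1, only d(n,0) of the antidiagonal sum survives, and it cancels R_{n+1}.
total-isolated : ∀ {N} (r : Fin N → Fin N → Bool) S z → z ∈ S →
  (∀ x y → x ∈ S → x ≢ z → y ∈ S → y ≢ z → r x y ≡ true) →
  (∀ x → x ∈ S → x ≢ z → r x z ≡ false × r z x ≡ false) →
  total circuit localDefect (later r) S ≗ 0ˢ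
total-isolated {N} r S z z∈S related unrelated i = begin
  total circuit localDefect (later r) S i
    ≡⟨ cong₂ _-ᶻ_ (cong (λ n → circuit n i +ᶻ antidiagonal localDefect n i) (card-remove S z z∈S))
                  (trans (sumFin-cong agree i) (sumFin-later-all φ⁺ S′ i)) ⟩
  circuit (suc n) i +ᶻ (localDefect n 0 i +ᶻ antidiagonal φ⁺ n i) -ᶻ antidiagonal φ⁺ n i
    ≡⟨ lem (circuit (suc n) i) _ (antidiagonal φ⁺ n i) ⟩
  circuit (suc n) i +ᶻ localDefect n 0 i
    ≡⟨ circuit-cancels n i ⟩
  0ℤ ∎
  where
  open ≡-Reasoning
  S′ = S ─ ⁅ z ⁆
  n = ∣ S′ ∣
  φ⁺ : ℕ → ℕ → Series
  φ⁺ a b = localDefect a (suc b)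
  lem : ∀ a b c → a +ᶻ (b +ᶻ c) -ᶻ c ≡ a +ᶻ b
  lem = solve-∀
  S′⇒ : ∀ {x} → x ∈ S′ → x ∈ S × x ≢ z
  S′⇒ x∈ = let x∈S , x∉ = x∈p─q⁻ S ⁅ z ⁆ x∈ in x∈S , x∉⁅y⁆⇒x≢y x∉
  ⇒S′ : ∀ {x} → x ∈ S → x ≢ z → x ∈ S′
  ⇒S′ x∈S x≢z = x∈p∧x∉q⇒x∈p─q x∈S (x≢y⇒x∉⁅y⁆ x≢z)
  agree : ∀ x → split localDefect x (later r x) S ≗ split φ⁺ x (later all x) S′
  agree x i with x ∈? S
  ... | no x∉S = cong (λ f → f i) (trans (split-outside localDefect x (later r x) S x∉S)
                   (sym (split-outside φ⁺ x (later all x) S′ (x∉S ∘ proj₁ ∘ S′⇒))))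
  ... | yes x∈S with x ≟ z
  ...   | yes refl = begin
    split localDefect x (later r x) S i   ≡⟨ cong (λ f → f i) (split-inside localDefect x (later r x) S x∈S) ⟩
    localDefect (∣ later r x ∩ S ∣) b i   ≡⟨ cong (λ a → localDefect a b i) empty ⟩
    localDefect 0 b i                     ≡⟨ defect-zeroˡ riordan motzkin b i ⟩
    0ℤ                                    ≡⟨ cong (λ f → f i) (split-outside φ⁺ x (later all x) S′ (λ x∈ → proj₂ (S′⇒ x∈) refl)) ⟨
    split φ⁺ x (later all x) S′ i         ∎
    where
    b : ℕ
    b = ∣ rest x (later r x) ∩ S ∣
    none : Empty (later r x ∩ S)
    none (y , y∈) = let y∈l , y∈S = x∈p∩q⁻ (later r x) S y∈ in
      contradiction (trans (sym (proj₁ (later⁻ r x y∈l))) (proj₂ (unrelated y y∈S λ { refl → x∉later r x y∈l }))) λ ()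
    empty : ∣ later r x ∩ S ∣ ≡ 0
    empty = trans (cong ∣_∣ (Empty-unique none)) (∣⊥∣≡0 N)
  ...   | no x≢z rewrite split-inside localDefect x (later r x) S x∈S
                       | split-inside φ⁺ x (later all x) S′ (⇒S′ x∈S x≢z) =
    cong₂ (λ a b → localDefect a b i) (cong ∣_∣ above) (+-cancelˡ-≡ ∣ later all x ∩ S′ ∣ _ _ (suc-injective
      (begin
        suc (∣ later all x ∩ S′ ∣ + ∣ rest x (later r x) ∩ S ∣)     ≡⟨ cong (λ X → suc (∣ X ∣ + ∣ rest x (later r x) ∩ S ∣)) above ⟨
        suc (∣ later r x ∩ S ∣ + ∣ rest x (later r x) ∩ S ∣)        ≡⟨ card-rest x (later r x) S (x∉later r x) x∈S ⟩
        ∣ S ∣                                                       ≡⟨ card-remove S z z∈S ⟩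
        suc ∣ S′ ∣                                                  ≡⟨ cong suc (card-rest x (later all x) S′ (x∉later all x) (⇒S′ x∈S x≢z)) ⟨
        suc (suc (∣ later all x ∩ S′ ∣ + ∣ rest x (later all x) ∩ S′ ∣)) ≡⟨ cong suc (+-suc ∣ later all x ∩ S′ ∣ _) ⟨
        suc (∣ later all x ∩ S′ ∣ + suc ∣ rest x (later all x) ∩ S′ ∣) ∎)))
    where
    above : later r x ∩ S ≡ later all x ∩ S′
    above = later-restrict r x S S′ (proj₁ ∘ S′⇒)
      (λ y y∈ → let y∈S , y≢z = S′⇒ y∈ in related x y x∈S x≢z y∈S y≢z)
      (λ y y∈S y∉ → helper y y∈S y∉)
      where
      helper : ∀ y → y ∈ S → y ∉ S′ → r x y ≡ false
      helper y y∈S y∉ with y ≟ z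
      ... | yes refl = proj₁ (unrelated x x∈S x≢z)
      ... | no y≢z   = contradiction (⇒S′ y∈S y≢z) y∉

-- Degree, symmetry and sign of the closed formulas

module Closure {K : Series → Set} (K-0 : K 0ˢ) (K-+ : ∀ {f g} → K f → K g → K (f +ˢ g)) where

  antidiagonal-closed : ∀ n {φ} → (∀ a b → suc (a + b) ≡ n → K (φ a b)) → K (antidiagonal φ n)
  antidiagonal-closed zero    p = K-0
  antidiagonal-closed (suc n) p = K-+ (p n 0 (cong suc (+-identityʳ n)))
    (antidiagonal-closed n λ a b e → p a (suc b) (cong suc (trans (+-suc a b) e)))

  sumFin-closed : ∀ {N} {f : Fin N → Series} → (∀ x → K (f x)) → K (sumFin f)
  sumFin-closed {zero}  p = K-0
  sumFin-closed {suc N} p = K-+ (p zero) (sumFin-closed (p ∘ suc))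

  split-closed : ∀ {N} φ x (A S : Subset N) → (x ∈ S → K (φ ∣ A ∩ S ∣ ∣ rest x A ∩ S ∣)) → K (split φ x A S)
  split-closed φ x A S p with x ∈? S
  ... | yes x∈S = subst K (sym (split-inside φ x A S x∈S)) (p x∈S)
  ... | no  x∉S = subst K (sym (split-outside φ x A S x∉S)) K-0

global-head : ∀ m → circuitZ (suc m) +ˢ antidiagonal globalDefect (suc m) ≗
              ↑ (circuitZ m) +ˢ antidiagonal (λ a b → globalDefect a (suc b)) m
global-head m i = trans (sym (ℤ.+-assoc (circuitZ (suc m) i) (globalDefect m 0 i) _))
  (cong (_+ᶻ antidiagonal (λ a b → globalDefect a (suc b)) m i) (circuitZ-cancels m i))

-- The successor is the second argument of the defect of x: `globalDefect-pal` and
-- `globalDefect-nonneg` require it to be positive.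
Spread : ∀ {N} → (Fin N → Fin N → Bool) → Subset N → Set
Spread r S = ∀ x → x ∈ S → ∃ λ b → ∣ rest x (later r x) ∩ S ∣ ≡ suc b

module _ {N} (r : Fin N → Fin N → Bool) (S : Subset N) where

  spread-split-closed : ∀ {K : Series → Set} (K-0 : K 0ˢ) (K-+ : ∀ {f g} → K f → K g → K (f +ˢ g)) φ →
    Spread r S → (∀ a b → 2 + (a + b) ≡ ∣ S ∣ → K (φ a (suc b))) →
    K (sumFin (λ x → split φ x (later r x) S))
  spread-split-closed {K} K-0 K-+ φ spread p = sumFin-closed λ x → split-closed φ x (later r x) S λ x∈S →
    let b , e = spread x x∈S
        a = ∣ later r x ∩ S ∣
    in subst (λ c → K (φ a c)) (sym e) (p a b (trans (cong suc (sym (+-suc a b)))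
         (trans (cong (λ c → suc (a + c)) (sym e)) (card-rest x (later r x) S (x∉later r x) x∈S))))
    where open Closure {K} K-0 K-+

  total-low : ∀ x → x ∈ S → Spread r S → Low 0 (suc ∣ S ∣) (total circuit localDefect (later r) S)
  total-low x x∈S spread = Low-- head (spread-split-closed {Low 0 (suc ∣ S ∣)} (λ _ _ → refl) Low-+ localDefect spread
    λ a b e → subst (λ m → Low 0 m (localDefect a (suc b)))
      (trans (cong (2 +_) (+-suc a b)) (cong suc e)) (localDefect-low a (suc b)))
    where
    m = ∣ S ─ ⁅ x ⁆ ∣
    φ⁺ : ℕ → ℕ → Series
    φ⁺ a b = localDefect a (suc b)
    cancel : circuit (suc m) +ˢ antidiagonal localDefect (suc m) ≗ antidiagonal φ⁺ m
    cancel i = trans (sym (ℤ.+-assoc (circuit (suc m) i) (localDefect m 0 i) (antidiagonal φ⁺ m i)))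
      (trans (cong (_+ᶻ antidiagonal φ⁺ m i) (circuit-cancels m i)) (ℤ.+-identityˡ _))
    head : Low 0 (suc ∣ S ∣) (circuit ∣ S ∣ +ˢ antidiagonal localDefect ∣ S ∣)
    head rewrite card-remove S x x∈S = λ i lt → trans (cancel i)
      (Closure.antidiagonal-closed {Low 0 (2 + m)} (λ _ _ → refl) Low-+ m
        (λ a b e → subst (λ k → Low 0 (2 + k) (φ⁺ a b)) (trans (+-suc a b) e) (localDefect-low a (suc b))) i lt)

  total-pal : ∀ x → x ∈ S → Spread r S → Pal 0 (2 + ∣ S ∣) (total circuitZ globalDefect (later r) S)
  total-pal x x∈S spread = Pal-- (head ∣ S ∣ two)
    (spread-split-closed {Pal 0 (2 + ∣ S ∣)} ((λ _ _ _ → refl) , λ _ _ → refl) Pal-+ globalDefect spread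
      λ a b e → subst (λ m → Pal 0 (2 + m) (globalDefect a (suc b))) e (globalDefect-pal a b))
    where
    -- After cancellation the head contains `↑ (circuitZ (∣ S ∣ - 1))`, and `circuitZ-pal` covers
    -- positive lengths only.
    two : 2 ≤ⁿ ∣ S ∣
    two = let b , e = spread x x∈S in
      subst (2 ≤ⁿ_) (card-rest x (later r x) S (x∉later r x) x∈S)
        (s≤s (≤-trans (subst (1 ≤ⁿ_) (sym e) (s≤s z≤n)) (m≤n+m _ _)))
    head : ∀ n → 2 ≤ⁿ n → Pal 0 (2 + n) (circuitZ n +ˢ antidiagonal globalDefect n)
    head (suc zero)    (s≤s ())
    head (suc (suc m)) _ = Pal-cong (λ i → sym (global-head (suc m) i)) (Pal-+ (Pal-↑ (circuitZ-pal m))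
      (Closure.antidiagonal-closed {Pal 0 (4 + m)} ((λ _ _ _ → refl) , λ _ _ → refl) Pal-+ (suc m)
        λ a b e → subst (λ k → Pal 0 (4 + k) (globalDefect a (suc b))) (suc-injective e) (globalDefect-pal a b)))

  defects-nonneg : Spread r S → 0ˢ ≼ sumFin (λ x → split globalDefect x (later r x) S)
  defects-nonneg spread = spread-split-closed {0ˢ ≼_} (λ _ → ℤ.≤-refl)
    (λ p q i → ℤ.+-mono-≤ (p i) (q i)) globalDefect spread λ a b _ → globalDefect-nonneg a b

  defects-trivial : (∀ x → Empty (later r x ∩ S)) → sumFin (λ x → split globalDefect x (later r x) S) ≗ 0ˢ
  defects-trivial empty = Closure.sumFin-closed {_≗ 0ˢ} (λ _ → refl) (λ p q i → cong₂ _+ᶻ_ (p i) (q i))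
    λ x → Closure.split-closed {_≗ 0ˢ} (λ _ → refl) (λ p q i → cong₂ _+ᶻ_ (p i) (q i)) globalDefect x (later r x) S
      λ _ i → trans (cong (λ a → globalDefect a (∣ rest x (later r x) ∩ S ∣) i)
        (trans (cong ∣_∣ (Empty-unique (empty x))) (∣⊥∣≡0 N)))
        (defect-zeroˡ (tilted riordan) (tilted motzkin) ∣ rest x (later r x) ∩ S ∣ i)

circuitZ-nonneg : ∀ n → 0ˢ ≼ circuitZ n
circuitZ-nonneg zero          = δ-nonneg 0
circuitZ-nonneg (suc n) i     = subst (0ℤ ≤_) (sym (tilted-return n 1ˢ i)) (↑-nonneg (narayana-nonneg n) i)

global-head-nonneg : ∀ m → 0ˢ ≼ circuitZ (suc m) +ˢ antidiagonal globalDefect (suc m)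
global-head-nonneg m i = subst (0ℤ ≤_) (sym (global-head m i))
  (ℤ.+-mono-≤ (↑-nonneg (circuitZ-nonneg m) i) (Closure.antidiagonal-closed {0ˢ ≼_} (λ _ → ℤ.≤-refl) (λ p q i → ℤ.+-mono-≤ (p i) (q i)) m
    (λ a b _ → globalDefect-nonneg a b) i))

-- Rank functions of rank 2 without loops

record DualRank {N} (E : Subset N) : Set where
  field
    ρ            : Subset N → ℕ
    ρ-⊥          : ρ ⊥ ≡ 0
    ρ-singleton  : ∀ {x} → x ∈ E → ρ ⁅ x ⁆ ≡ 1
    ρ-mono       : ∀ X Y → X ⊆ Y → Y ⊆ E → ρ X ≤ⁿ ρ Y
    ρ-submodular : ∀ X Y → X ⊆ E → Y ⊆ E → ρ (X ∪ Y) + ρ (X ∩ Y) ≤ⁿ ρ X + ρ Y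
    ρ-E          : ρ E ≡ 2

  pair : Fin N → Fin N → Subset N
  pair x y = ⁅ x ⁆ ∪ ⁅ y ⁆

  parallel : Fin N → Fin N → Bool
  parallel x y = does (ρ (pair x y) ≤? 1)

  pair⊆ : ∀ {S x y} → x ∈ S → y ∈ S → pair x y ⊆ S
  pair⊆ {S} {x} {y} x∈ y∈ z∈ = [ ⁅x⁆⊆ x∈ , ⁅x⁆⊆ y∈ ]′ (x∈p∪q⁻ ⁅ x ⁆ ⁅ y ⁆ z∈)

  parallel-true : ∀ {x y} → ρ (pair x y) ≤ⁿ 1 → parallel x y ≡ true
  parallel-true = dec-true (_ ≤? 1)

  parallel-false : ∀ {x y} → ¬ ρ (pair x y) ≤ⁿ 1 → parallel x y ≡ false
  parallel-false = dec-false (_ ≤? 1)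

  parallel⇒≤1 : ∀ {x y} → parallel x y ≡ true → ρ (pair x y) ≤ⁿ 1
  parallel⇒≤1 {x} {y} e with ρ (pair x y) ≤? 1
  ... | yes le = le
  ... | no nle = contradiction (trans (sym e) (parallel-false nle)) λ ()

  ρ≤2 : ∀ S → S ⊆ E → ρ S ≤ⁿ 2
  ρ≤2 S S⊆E = subst (ρ S ≤ⁿ_) ρ-E (ρ-mono S E S⊆E id)

  ρ>0 : ∀ {S x} → S ⊆ E → x ∈ S → 1 ≤ⁿ ρ S
  ρ>0 {S} {x} S⊆E x∈S = subst (_≤ⁿ ρ S) (ρ-singleton (S⊆E x∈S)) (ρ-mono ⁅ x ⁆ S (⁅x⁆⊆ x∈S) S⊆E)

  -- Two sets of rank at most 1 that share x have a union of rank at most 1, by submodularity and ρ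
  -- ⁅ x ⁆ = 1. So the elements y can be added one at a time.
  star : ∀ S x → S ⊆ E → x ∈ S → (∀ y → y ∈ S → ρ (pair x y) ≤ⁿ 1) → ρ S ≤ⁿ 1
  star S x S⊆E x∈S near = ≤-trans (ρ-mono S (⁅ x ⁆ ∪ S) (q⊆p∪q ⁅ x ⁆ S) (∪⊆ S id)) (go (suc ∣ S ∣) S id ≤-refl)
    where
    ∪⊆ : ∀ Y → Y ⊆ S → ⁅ x ⁆ ∪ Y ⊆ E
    ∪⊆ Y Y⊆S z∈ = S⊆E ([ ⁅x⁆⊆ x∈S , Y⊆S ]′ (x∈p∪q⁻ ⁅ x ⁆ Y z∈))
    go : ∀ k Y → Y ⊆ S → ∣ Y ∣ < k → ρ (⁅ x ⁆ ∪ Y) ≤ⁿ 1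
    go (suc k) Y Y⊆S (s≤s le) with nonempty? Y
    ... | no ¬ne rewrite Empty-unique ¬ne | ∪-identityʳ ⁅ x ⁆ = ≤-reflexive (ρ-singleton (S⊆E x∈S))
    ... | yes (y , y∈Y) = +-cancelʳ-≤ 1 _ 1 (begin
      ρ (⁅ x ⁆ ∪ Y) + 1                         ≤⟨ +-mono-≤ (ρ-mono _ (X ∪ W) union X∪W⊆E)
                                                     (ρ>0 (X⊆E ∘ p∩q⊆p X W) (x∈p∩q⁺ (p⊆p∪q Y′ x∈⁅x⁆′ , p⊆p∪q ⁅ y ⁆ x∈⁅x⁆′))) ⟩
      ρ (X ∪ W) + ρ (X ∩ W)                     ≤⟨ ρ-submodular X W X⊆E W⊆E ⟩
      ρ X + ρ W                                 ≤⟨ +-mono-≤ (go k Y′ Y′⊆S (<-≤-trans (x∈p⇒∣p-x∣<∣p∣ y∈Y) le)) (near y (Y⊆S y∈Y)) ⟩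
      2                                         ∎)
      where
      open ≤-Reasoning
      Y′ X W : Subset N
      Y′ = Y - y
      X = ⁅ x ⁆ ∪ Y′
      W = pair x y
      x∈⁅x⁆′ = x∈⁅x⁆ x
      Y′⊆S : Y′ ⊆ S
      Y′⊆S = Y⊆S ∘ p─q⊆p Y ⁅ y ⁆
      X⊆E : X ⊆ E
      X⊆E = ∪⊆ Y′ Y′⊆S
      W⊆E : W ⊆ E
      W⊆E = S⊆E ∘ pair⊆ x∈S (Y⊆S y∈Y)
      X∪W⊆E : X ∪ W ⊆ E
      X∪W⊆E z∈ = [ X⊆E , W⊆E ]′ (x∈p∪q⁻ X W z∈)
      union : ⁅ x ⁆ ∪ Y ⊆ X ∪ W
      union {z} z∈ with x∈p∪q⁻ ⁅ x ⁆ Y z∈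
      ... | inj₁ z∈x = p⊆p∪q W (p⊆p∪q Y′ z∈x)
      ... | inj₂ z∈Y with z ≟ y
      ...   | yes refl = q⊆p∪q X W (q⊆p∪q ⁅ x ⁆ ⁅ z ⁆ (x∈⁅x⁆ z))
      ...   | no z≢y   = p⊆p∪q W (q⊆p∪q ⁅ x ⁆ Y′ (x∈p∧x≢y⇒x∈p-y z∈Y z≢y))

  pair-idem : ∀ {x} → x ∈ E → ρ (pair x x) ≤ⁿ 1
  pair-idem {x} x∈E rewrite ∪-idem ⁅ x ⁆ = ≤-reflexive (ρ-singleton x∈E)

  rank≤1⇒parallel : ∀ {S} → S ⊆ E → ρ S ≤ⁿ 1 → ∀ x y → x ∈ S → y ∈ S → parallel x y ≡ true
  rank≤1⇒parallel {S} S⊆E le x y x∈ y∈ =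
    parallel-true (≤-trans (ρ-mono (pair x y) S (pair⊆ x∈ y∈) S⊆E) le)

  -- For a matroid M with ground set S dual to ρ, these are t^ρ(S) P_M and
  -- t^ρ(S) Z_M.
  local global : Subset N → Series
  local  = total circuit localDefect (later parallel)
  global = total circuitZ globalDefect (later parallel)

  local-rank≤1 : ∀ {S} → S ⊆ E → ρ S ≤ⁿ 1 → local S ≗ circuit ∣ S ∣
  local-rank≤1 {S} S⊆E le = total-all circuit localDefect parallel S (rank≤1⇒parallel S⊆E le)

  global-rank≤1 : ∀ {S} → S ⊆ E → ρ S ≤ⁿ 1 → global S ≗ circuitZ ∣ S ∣
  global-rank≤1 {S} S⊆E le = total-all circuitZ globalDefect parallel S (rank≤1⇒parallel S⊆E le)

  -- If nothing remained, every other element of S would be parallel to x, and `star` would bound ρ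
  -- S by 1.
  spread : ∀ {S} → S ⊆ E → ρ S ≡ 2 → Spread parallel S
  spread {S} S⊆E ρS≡2 x x∈S with ∣ rest x (later parallel x) ∩ S ∣ in eq
  ... | suc b = b , refl
  ... | zero  = contradiction (subst (_≤ⁿ 1) ρS≡2 (star S x S⊆E x∈S near)) λ { (s≤s ()) }
    where
    near : ∀ y → y ∈ S → ρ (pair x y) ≤ⁿ 1
    near y y∈S with y ≟ x
    ... | yes refl = pair-idem (S⊆E y∈S)
    ... | no y≢x with y ∈? later parallel x
    ...   | yes y∈l = parallel⇒≤1 (proj₁ (later⁻ parallel x y∈l))
    ...   | no  y∉l = contradiction
      (subst₂ _≤ⁿ_ (∣⁅x⁆∣≡1 y) eq (p⊆q⇒∣p∣≤∣q∣ (⁅x⁆⊆ (x∈p∩q⁺ (x∉p⇒x∈∁p outside-both , y∈S))))) λ ()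
      where
      outside-both : y ∉ ⁅ x ⁆ ∪ later parallel x
      outside-both y∈ = [ (λ y∈x → y≢x (x∈⁅y⁆⇒x≡y x y∈x)) , y∉l ]′ (x∈p∪q⁻ ⁅ x ⁆ _ y∈)

  -- z is a coloop of the restriction to S.
  local-coloop : ∀ {S z} → S ⊆ E → z ∈ S → ρ S ≡ suc (ρ (S ─ ⁅ z ⁆)) → local S ≗ 0ˢ
  local-coloop {S} {z} S⊆E z∈S drop with ρ (S ─ ⁅ z ⁆) in eq
  ... | suc (suc _) = contradiction (subst (_≤ⁿ 2) drop (ρ≤2 S S⊆E)) λ { (s≤s (s≤s ())) }
  -- Here S = ⁅ z ⁆, and there is no Riordan path of length 1 from 0 to 0.
  ... | zero = λ i → trans (local-rank≤1 S⊆E (≤-reflexive drop) i) (trans (cong (λ n → circuit n i) single) (circuit-1 i))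
    where
    none : Empty (S ─ ⁅ z ⁆)
    none (y , y∈) = contradiction (subst (1 ≤ⁿ_) eq (ρ>0 (S⊆E ∘ p─q⊆p S ⁅ z ⁆) y∈)) λ ()
    single : ∣ S ∣ ≡ 1
    single = trans (card-remove S z z∈S) (cong suc (trans (cong ∣_∣ (Empty-unique none)) (∣⊥∣≡0 N)))
    circuit-1 : circuit 1 ≗ 0ˢ
    circuit-1 zero    = refl
    circuit-1 (suc i) = refl
  ... | suc zero = total-isolated parallel S z z∈S
    (λ x y x∈ x≢z y∈ y≢z → rank≤1⇒parallel (S⊆E ∘ p─q⊆p S ⁅ z ⁆) (≤-reflexive eq) x y (∈S′ x∈ x≢z) (∈S′ y∈ y≢z))
    λ x x∈ x≢z → parallel-false (far x∈ x≢z) ,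
                 parallel-false (subst (λ X → ¬ ρ X ≤ⁿ 1) (∪-comm ⁅ x ⁆ ⁅ z ⁆) (far x∈ x≢z))
    where
    ∈S′ : ∀ {x} → x ∈ S → x ≢ z → x ∈ S ─ ⁅ z ⁆
    ∈S′ x∈ x≢z = x∈p∧x≢y⇒x∈p-y x∈ x≢z
    far : ∀ {x} → x ∈ S → x ≢ z → ¬ ρ (pair x z) ≤ⁿ 1
    far {x} x∈ x≢z le = contradiction (subst (_≤ⁿ 1) drop (star S x S⊆E x∈ near)) λ { (s≤s ()) }
      where
      near : ∀ y → y ∈ S → ρ (pair x y) ≤ⁿ 1
      near y y∈S with y ≟ z
      ... | yes refl = le
      ... | no y≢z   = subst (ρ (pair x y) ≤ⁿ_) eq
        (ρ-mono _ _ (pair⊆ (∈S′ x∈ x≢z) (∈S′ y∈S y≢z)) (S⊆E ∘ p─q⊆p S ⁅ z ⁆))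

  overSubsets-local : ∀ S → overSubsets S local ≗ global S
  overSubsets-local S i = trans (overSubsets-total S circuit localDefect (later parallel) (x∉later parallel) i)
    (-cong (+-cong (binomial-iter riordan-natural ∣ S ∣ δ 0)
        (antidiagonal-preserves congruent-compatible ∣ S ∣ {χ = λ _ _ → 0ˢ} transform))
      (sumFin-cong λ x → when-cong (lookup S x)
        (transform ∣ later parallel x ∩ S ∣ ∣ rest x (later parallel x) ∩ S ∣)) i)
    where
    transform : ∀ a b → binomial₂ a b localDefect ≗ globalDefect a b
    transform = binomial₂-defect riordan-natural motzkin-natural

-- From polynomials to series

shift : ℕ → Series → Series
shift zero    f = f
shift (suc k) f = ↑ (shift k f)

shift-+ : ∀ j k f → shift (j + k) f ≡ shift j (shift k f)
shift-+ zero    k f = refl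
shift-+ (suc j) k f = cong ↑ (shift-+ j k f)

shift-comm : ∀ j k f → shift j (shift k f) ≡ shift k (shift j f)
shift-comm j k f = trans (sym (shift-+ j k f)) (trans (cong (λ n → shift n f) (+-comm j k)) (shift-+ k j f))

shift-preserves : ∀ {Q} (c : Compatible Q) k {f g h} → Q f g h → Q (shift k f) (shift k g) (shift k h)
shift-preserves c zero    q = q
shift-preserves c (suc k) q = ↑-closed c (shift-preserves c k q)

shift-cong : ∀ k {f g} → f ≗ g → shift k f ≗ shift k g
shift-cong k {f} {g} = shift-preserves congruent-compatible k {f} {g} {f}

shift-distrib : ∀ k f g → shift k f +ˢ shift k g ≗ shift k (f +ˢ g)
shift-distrib k f g = shift-preserves sum-compatible k {f} {g} λ _ → refl

shift-zero : ∀ k → shift k 0ˢ ≗ 0ˢ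
shift-zero zero    i       = refl
shift-zero (suc k) zero    = refl
shift-zero (suc k) (suc i) = shift-zero k i

shift-low : ∀ k {n f} → Low 0 n f → Low 0 (k + (k + n)) (shift k f)
shift-low zero    p = p
shift-low (suc k) {n} {f} p = subst (λ m → Low 0 (suc m) (shift (suc k) f)) (sym (+-suc k (k + n))) (Low-↑ (shift-low k p))

shift-pal : ∀ k {n f} → Pal 0 n f → Pal 0 (k + (k + n)) (shift k f)
shift-pal zero    p = p
shift-pal (suc k) {n} {f} p = subst (λ m → Pal 0 (suc m) (shift (suc k) f)) (sym (+-suc k (k + n))) (Pal-↑ (shift-pal k p))

coeff-t^ : ∀ k p → coeff (t^ k · p) ≗ shift k (coeff p)
coeff-t^ zero    p i       = refl
coeff-t^ (suc k) p zero    = refl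
coeff-t^ (suc k) p (suc i) = coeff-t^ k p i

palindromic⇒Pal : ∀ r z → Palindromic r z → Pal 0 r (coeff z)
palindromic⇒Pal r z (mirror , high) =
  (λ i j e → sym (trans (cong (coeff z) (j≡ i j e)) (mirror i (i≤ i j e)))) ,
  λ i lt → high i (subst (r <_) (+-identityʳ i) lt)
  where
  i+j : ∀ i j → i + j + 0 ≡ r → i + j ≡ r
  i+j i j e = trans (sym (+-identityʳ (i + j))) e
  i≤ : ∀ i j → i + j + 0 ≡ r → i ≤ⁿ r
  i≤ i j e = subst (i ≤ⁿ_) (i+j i j e) (m≤m+n i j)
  j≡ : ∀ i j → i + j + 0 ≡ r → j ≡ r ∸ i
  j≡ i j e = trans (sym (m+n∸m≡n i j)) (cong (_∸ i) (i+j i j e))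

-- If 2i ≤ m, the mirror index m + 1 - i exceeds the degree bound, so both sums equal w there and
-- hence agree at i. This is the uniqueness of Kazhdan-Lusztig polynomials, in a form that survives
-- multiplication by a power of t.
low-unique : ∀ m f g w → Low 0 m f → Low 0 m g → Pal 0 (suc m) (f +ˢ w) → Pal 0 (suc m) (g +ˢ w) → f ≗ g
low-unique m f g w lf lg pf pg i with suc m ≤? 2 * i
... | yes le = trans (lf i (high {i} le)) (sym (lg i (high {i} le)))
  where
  high : ∀ {i} → suc m ≤ⁿ 2 * i → m < 2 * i + 0
  high {i} le = subst (m <_) (sym (+-identityʳ (2 * i))) le
... | no nle = ∙-cancelʳ (w i) (f i) (g i) (begin
  f i +ᶻ w i  ≡⟨ proj₁ pf i j i+j ⟩
  f j +ᶻ w j  ≡⟨ cong (_+ᶻ w j) (trans (lf j high) (sym (lg j high))) ⟩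
  g j +ᶻ w j  ≡⟨ proj₁ pg i j i+j ⟨
  g i +ᶻ w i  ∎)
  where
  open ≡-Reasoning
  j = suc m ∸ i
  i+i≤m : i + i ≤ⁿ m
  i+i≤m = subst (_≤ⁿ m) (cong (i +_) (+-identityʳ i)) (s≤s⁻¹ (≰⇒> nle))
  i≤ : i ≤ⁿ suc m
  i≤ = ≤-trans (m≤m+n i i) (m≤n⇒m≤1+n i+i≤m)
  i+j : i + j + 0 ≡ suc m
  i+j = trans (+-identityʳ (i + j)) (m+[n∸m]≡n i≤)
  i≤j : i ≤ⁿ j
  i≤j = subst (_≤ⁿ j) (m+n∸n≡m i i) (∸-monoˡ-≤ i (m≤n⇒m≤1+n i+i≤m))
  high : m < 2 * j + 0
  high = subst₂ _≤ⁿ_ (m+[n∸m]≡n i≤) (trans (cong (j +_) (sym (+-identityʳ j))) (sym (+-identityʳ (2 * j)))) (+-monoˡ-≤ j i≤j)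

sumSubsets : ∀ {N} → (Subset N → Series) → Series
sumSubsets {zero}  h = h []
sumSubsets {suc N} h = sumSubsets (h ∘ (outside ∷_)) +ˢ sumSubsets (h ∘ (inside ∷_))

sumSubsets-zero : ∀ {N} {h : Subset N → Series} → (∀ F → h F ≗ 0ˢ) → sumSubsets h ≗ 0ˢ
sumSubsets-zero {zero}  e = e []
sumSubsets-zero {suc N} e i =
  cong₂ _+ᶻ_ (sumSubsets-zero (e ∘ (outside ∷_)) i) (sumSubsets-zero (e ∘ (inside ∷_)) i)

shift-sumOverSubsets : ∀ k N f → shift k (coeff (sumOverSubsets N f)) ≗ sumSubsets (λ F → shift k (coeff (f F)))
shift-sumOverSubsets k zero    f i = refl
shift-sumOverSubsets k (suc N) f i = trans
  (shift-cong k (coeff-⊕ (sumOverSubsets N (f ∘ (outside ∷_))) (sumOverSubsets N (f ∘ (inside ∷_)))) i)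
  (trans (sym (shift-distrib k (coeff (sumOverSubsets N (f ∘ (outside ∷_)))) (coeff (sumOverSubsets N (f ∘ (inside ∷_)))) i))
         (cong₂ _+ᶻ_ (shift-sumOverSubsets k N (f ∘ (outside ∷_)) i) (shift-sumOverSubsets k N (f ∘ (inside ∷_)) i)))

sumSubsets-complement : ∀ {N} (E : Subset N) (h g : Subset N → Series) →
  (∀ F → F ⊆ E → h F ≗ shift ∣ F ∣ (g (E ─ F))) → (∀ F → ¬ F ⊆ E → h F ≗ 0ˢ) →
  sumSubsets h ≗ overSubsets E g
sumSubsets-complement []            h g p q = p [] id
sumSubsets-complement (outside ∷ E) h g p q i = trans (cong₂ _+ᶻ_
    (sumSubsets-complement E (h ∘ (outside ∷_)) (g ∘ (outside ∷_))
      (λ F F⊆E → p (outside ∷ F) (out⊆ F⊆E)) (λ F F⊈E → q (outside ∷ F) (F⊈E ∘ drop-∷-⊆)) i)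
    (sumSubsets-zero (λ F → q (inside ∷ F) λ ⊆E → contradiction (⊆E here) λ ()) i))
  (ℤ.+-identityʳ _)
sumSubsets-complement (inside ∷ E) h g p q i = trans (cong₂ _+ᶻ_
    (sumSubsets-complement E (h ∘ (outside ∷_)) (g ∘ (inside ∷_))
      (λ F F⊆E → p (outside ∷ F) (out⊆ F⊆E)) (λ F F⊈E → q (outside ∷ F) (F⊈E ∘ drop-∷-⊆)) i)
    (trans (sumSubsets-complement E (h ∘ (inside ∷_)) (λ S → ↑ (g (outside ∷ S)))
      (λ F F⊆E i → trans (p (inside ∷ F) (in⊆in F⊆E) i)
        (cong (λ f → f i) (shift-comm 1 ∣ F ∣ (g (outside ∷ (E ─ F))))))
      (λ F F⊈E → q (inside ∷ F) (F⊈E ∘ drop-∷-⊆)) i)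
     (sym (overSubsets-preserves shift-compatible E {g ∘ (outside ∷_)} {g ∘ (outside ∷_)} (λ _ _ → refl) i))))
  (ℤ.+-comm _ (↑ (overSubsets E (g ∘ (outside ∷_))) i))

-- The term of F = ∅ is supplied separately.
sumSubsets-complement-⊥ : ∀ {N} (E : Subset N) (h g : Subset N → Series) → h ⊥ ≗ 0ˢ →
  (∀ F → F ≢ ⊥ → F ⊆ E → h F ≗ shift ∣ F ∣ (g (E ─ F))) → (∀ F → ¬ F ⊆ E → h F ≗ 0ˢ) →
  g E +ˢ sumSubsets h ≗ overSubsets E g
sumSubsets-complement-⊥ []            h g z p q i = trans (cong (g [] i +ᶻ_) (z i)) (ℤ.+-identityʳ (g [] i))
sumSubsets-complement-⊥ (outside ∷ E) h g z p q i = trans (cong (g (outside ∷ E) i +ᶻ_) (trans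
    (cong (sumSubsets (h ∘ (outside ∷_)) i +ᶻ_)
      (sumSubsets-zero (λ F → q (inside ∷ F) λ ⊆E → contradiction (⊆E here) λ ()) i))
    (ℤ.+-identityʳ _)))
  (sumSubsets-complement-⊥ E (h ∘ (outside ∷_)) (g ∘ (outside ∷_)) z
      (λ F F≢⊥ F⊆E → p (outside ∷ F) (λ { refl → F≢⊥ refl }) (out⊆ F⊆E))
      (λ F F⊈E → q (outside ∷ F) (F⊈E ∘ drop-∷-⊆)) i)
sumSubsets-complement-⊥ (inside ∷ E) h g z p q i =
  trans (sym (ℤ.+-assoc (g (inside ∷ E) i) (sumSubsets (h ∘ (outside ∷_)) i) _)) (trans (cong₂ _+ᶻ_
    (sumSubsets-complement-⊥ E (h ∘ (outside ∷_)) (g ∘ (inside ∷_)) z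
      (λ F F≢⊥ F⊆E → p (outside ∷ F) (λ { refl → F≢⊥ refl }) (out⊆ F⊆E))
      (λ F F⊈E → q (outside ∷ F) (F⊈E ∘ drop-∷-⊆)) i)
    (trans (sumSubsets-complement E (h ∘ (inside ∷_)) (λ S → ↑ (g (outside ∷ S)))
      (λ F F⊆E i → trans (p (inside ∷ F) (λ ()) (in⊆in F⊆E) i)
        (cong (λ f → f i) (shift-comm 1 ∣ F ∣ (g (outside ∷ (E ─ F))))))
      (λ F F⊈E → q (inside ∷ F) (F⊈E ∘ drop-∷-⊆)) i)
     (sym (overSubsets-preserves shift-compatible E {g ∘ (outside ∷_)} {g ∘ (outside ∷_)} (λ _ _ → refl) i))))
  (ℤ.+-comm _ (↑ (overSubsets E (g ∘ (outside ∷_))) i)))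

-- Loops, contractions and duality

loop-exists : ∀ {N} (M : Matroid N) → ¬ Loopless M → ∃ (IsLoop M)
loop-exists {N} M ¬ll = let x , ¬¬l = ¬∀⟶∃¬ N (λ x → ¬ IsLoop M x) (λ x → ¬? (isLoop? x)) ¬ll
                        in x , decidable-stable (isLoop? x) ¬¬l
  where
  isLoop? : ∀ x → Dec (IsLoop M x)
  isLoop? x = (x ∈? ground M) ×-dec (rank M ⁅ x ⁆ ℕ.≟ 0)

contract-loopless⇒flat : ∀ {N} (M : Matroid N) F (F⊆ : F ⊆ ground M) → Loopless (contract M F F⊆) → IsFlat M F
contract-loopless⇒flat M F F⊆ ll = F⊆ , λ x x∈ x∉ → ≰⇒> λ le →
  ll x (x∈p∧x∉q⇒x∈p─q x∈ x∉ , m≤n⇒m∸n≡0 (subst (λ X → rank M X ≤ⁿ rank M F) (∪-comm F ⁅ x ⁆) le))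

card-disjoint : ∀ {N} (A F : Subset N) → (∀ {x} → x ∈ A → x ∉ F) → ∣ A ∪ F ∣ ≡ ∣ A ∣ + ∣ F ∣
card-disjoint []            []            d = refl
card-disjoint (inside  ∷ A) (inside  ∷ F) d = contradiction here (d here)
card-disjoint (inside  ∷ A) (outside ∷ F) d = cong suc (card-disjoint A F λ x∈ x∈′ → d (there x∈) (there x∈′))
card-disjoint (outside ∷ A) (inside  ∷ F) d = trans (cong suc (card-disjoint A F λ x∈ x∈′ → d (there x∈) (there x∈′)))
                                                     (sym (+-suc ∣ A ∣ ∣ F ∣))
card-disjoint (outside ∷ A) (outside ∷ F) d = card-disjoint A F λ x∈ x∈′ → d (there x∈) (there x∈′)

module _ {N} {E : Subset N} (D : DualRank E) where
  open DualRank D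

  -- ρ restricted to the ground set of M is the rank function of the dual of M.
  IsDualOf : Matroid N → Set
  IsDualOf M = ground M ⊆ E × (∀ A → A ⊆ ground M → rank M A + ρ (ground M) ≡ ∣ A ∣ + ρ (ground M ─ A))

  dual-rk : ∀ M → IsDualOf M → rk M + ρ (ground M) ≡ ∣ ground M ∣
  dual-rk M (_ , dual) = trans (dual (ground M) id) (trans (cong (∣ ground M ∣ +_)
    (trans (cong ρ (trans (cong (ground M ─_) (sym (∪-identityʳ _))) none)) ρ-⊥)) (+-identityʳ _))
    where
    none : ground M ─ (ground M ∪ ⊥) ≡ ⊥
    none = Empty-unique λ (x , x∈) → let x∈S , x∉ = x∈p─q⁻ (ground M) (ground M ∪ ⊥) x∈ in x∉ (p⊆p∪q ⊥ x∈S)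

  -- Contraction is deletion in the dual, so one ρ serves all contractions. Adding rank M F + ρ S to
  -- both sides removes the truncated subtraction.
  dual-contract : ∀ M → IsDualOf M → ∀ F (F⊆ : F ⊆ ground M) → IsDualOf (contract M F F⊆)
  dual-contract M (S⊆E , dual) F F⊆ = S⊆E ∘ p─q⊆p (ground M) F , λ A A⊆ → +-cancelˡ-≡ (rank M F + ρ S) _ _ (begin
    rank M F + ρ S + (rank M (A ∪ F) ∸ rank M F + ρ (S ─ F))
      ≡⟨ regroup (rank M F) (ρ S) (rank M (A ∪ F) ∸ rank M F) (ρ (S ─ F)) ⟩
    (rank M F + (rank M (A ∪ F) ∸ rank M F)) + ρ S + ρ (S ─ F)
      ≡⟨ cong (λ x → x + ρ S + ρ (S ─ F)) (m+[n∸m]≡n (rank-mono M F (A ∪ F) (q⊆p∪q A F) (∪⊆ A A⊆))) ⟩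
    rank M (A ∪ F) + ρ S + ρ (S ─ F)
      ≡⟨ cong (_+ ρ (S ─ F)) (dual (A ∪ F) (∪⊆ A A⊆)) ⟩
    ∣ A ∪ F ∣ + ρ (S ─ (A ∪ F)) + ρ (S ─ F)
      ≡⟨ cong₂ (λ x y → x + ρ y + ρ (S ─ F)) (card-disjoint A F λ x∈ → proj₂ (x∈p─q⁻ S F (A⊆ x∈)))
           (trans (cong (S ─_) (∪-comm A F)) (sym (p─q─r≡p─q∪r S F A))) ⟩
    ∣ A ∣ + ∣ F ∣ + ρ (S ─ F ─ A) + ρ (S ─ F)
      ≡⟨ regroup′ ∣ A ∣ ∣ F ∣ (ρ (S ─ F ─ A)) (ρ (S ─ F)) ⟩
    (∣ F ∣ + ρ (S ─ F)) + (∣ A ∣ + ρ (S ─ F ─ A))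
      ≡⟨ cong (_+ (∣ A ∣ + ρ (S ─ F ─ A))) (dual F F⊆) ⟨
    rank M F + ρ S + (∣ A ∣ + ρ (S ─ F ─ A)) ∎)
    where
    open ≡-Reasoning
    S = ground M
    ∪⊆ : ∀ A → A ⊆ S ─ F → A ∪ F ⊆ S
    ∪⊆ A A⊆ x∈ = [ p─q⊆p S F ∘ A⊆ , F⊆ ]′ (x∈p∪q⁻ A F x∈)
    regroup : ∀ a b c d → a + b + (c + d) ≡ a + c + b + d
    regroup = ℕ-Ring.solve-∀
    regroup′ : ∀ a b c d → a + b + c + d ≡ (b + d) + (a + c)
    regroup′ = ℕ-Ring.solve-∀

-- Identification of the Kazhdan-Lusztig and Z-polynomials

module _ (P : Assignment) (isKL : IsKazhdanLusztig P) {N} {E : Subset N} (D : DualRank E) where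
  open IsKazhdanLusztig isKL
  open DualRank D

  private
    -- For a loop z, duality at ⁅ z ⁆ reads 0 + ρ S = 1 + ρ (S ─ ⁅ z ⁆), where S is the ground set;
    -- so z is a coloop of ρ on S.
    local-loops : ∀ (M : Matroid N) → IsDualOf D M → ¬ Loopless M → local (ground M) ≗ 0ˢ
    local-loops M (S⊆E , dual) ¬ll = let z , z∈ , r≡0 = loop-exists M ¬ll in
      local-coloop S⊆E z∈ (trans (sym (cong (_+ ρ (ground M)) r≡0))
        (trans (dual ⁅ z ⁆ (⁅x⁆⊆ z∈)) (cong (_+ ρ (ground M ─ ⁅ z ⁆)) (∣⁅x⁆∣≡1 z))))

    local-rank0 : ∀ (M : Matroid N) → IsDualOf D M → Loopless M → rk M ≡ 0 →
                  shift (ρ (ground M)) (coeff (P M)) ≗ local (ground M)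
    local-rank0 M (S⊆E , dual) ll r≡0 i = begin
      shift (ρ S) (coeff (P M)) i  ≡⟨ cong (λ k → shift k (coeff (P M)) i) (trans (cong ρ S≡⊥) ρ-⊥) ⟩
      coeff (P M) i                ≡⟨ rank-zero M ll r≡0 i ⟩
      coeff (1ℤ ∷ []) i            ≡⟨ one i ⟩
      circuit 0 i                  ≡⟨ cong (λ n → circuit n i) (trans (cong ∣_∣ S≡⊥) (∣⊥∣≡0 N)) ⟨
      circuit ∣ S ∣ i              ≡⟨ local-rank≤1 S⊆E (subst (_≤ⁿ 1) (sym (trans (cong ρ S≡⊥) ρ-⊥)) z≤n) i ⟨
      local S i                    ∎
      where
      open ≡-Reasoning
      S = ground M
      S≡⊥ : S ≡ ⊥
      S≡⊥ with ≡-dec Bool._≟_ S ⊥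
      ... | yes e = e
      ... | no ne = contradiction r≡0 (>⇒≢ (loopless-rank>0 M ll S id ne))
      one : coeff (1ℤ ∷ []) ≗ circuit 0
      one zero    = refl
      one (suc i) = refl

    properTerm-local : ∀ (M : Matroid N) → IsDualOf D M → ∀ F → F ≢ ⊥ → (F⊆ : F ⊆ ground M) →
      shift (ρ (ground M ─ F)) (coeff (P (contract M F F⊆))) ≗ local (ground M ─ F) →
      shift (ρ (ground M)) (coeff (properTerm P M F)) ≗ shift ∣ F ∣ (local (ground M ─ F))
    properTerm-local M d@(S⊆E , dual) F F≢⊥ F⊆ ih i =
      trans (shift-cong (ρ S) (λ j → sym (properTerm-≢ P M F F≢⊥ j)) i) flat
      where
      open ≡-Reasoning
      S = ground M
      flat : shift (ρ S) (coeff (flatTerm P M F)) i ≡ shift ∣ F ∣ (local (S ─ F)) i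
      flat with isFlat? M F
      ... | yes (F⊆′ , _) = begin
        shift (ρ S) (coeff (t^ rank M F · P (contract M F F⊆′))) i  ≡⟨ shift-cong (ρ S) (coeff-t^ (rank M F) _) i ⟩
        shift (ρ S) (shift (rank M F) c) i                          ≡⟨ cong (λ f → f i) (shift-+ (ρ S) (rank M F) c) ⟨
        shift (ρ S + rank M F) c i                                  ≡⟨ cong (λ k → shift k c i) (trans (+-comm (ρ S) _) (dual F F⊆)) ⟩
        shift (∣ F ∣ + ρ (S ─ F)) c i                               ≡⟨ cong (λ f → f i) (shift-+ ∣ F ∣ (ρ (S ─ F)) c) ⟩
        shift (∣ F ∣) (shift (ρ (S ─ F)) c) i                       ≡⟨ shift-cong (∣ F ∣) agree i ⟩
        shift (∣ F ∣) (local (S ─ F)) i                             ∎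
        where
        c = coeff (P (contract M F F⊆′))
        same : c ≗ coeff (P (contract M F F⊆))
        same = respects-≋ _ _ (≋-contract M M (≋-refl M) F F⊆′ F⊆)
        agree : shift (ρ (S ─ F)) c ≗ local (S ─ F)
        agree j = trans (shift-cong (ρ (S ─ F)) same j) (ih j)
      -- The term is 0 by definition; `local` matches it because contracting a set that is not a
      -- flat creates a loop.
      ... | no ¬flat = trans (shift-zero (ρ S) i)
          (sym (trans (shift-cong ∣ F ∣ vanishes i) (shift-zero ∣ F ∣ i)))
        where
        vanishes : local (S ─ F) ≗ 0ˢ
        vanishes = local-loops (contract M F F⊆) (dual-contract D M d F F⊆) (¬flat ∘ contract-loopless⇒flat M F F⊆)

    properTerm-outside : ∀ (M : Matroid N) F → ¬ F ⊆ ground M → ∀ k → shift k (coeff (properTerm P M F)) ≗ 0ˢ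
    properTerm-outside M F F⊈ k i = trans (shift-cong k zeros i) (shift-zero k i)
      where
      zeros : coeff (properTerm P M F) ≗ 0ˢ
      zeros i with ≡-dec Bool._≟_ F ⊥
      ... | yes _ = refl
      ... | no _ with isFlat? M F
      ...   | yes (F⊆ , _) = ⊥-elim (F⊈ F⊆)
      ...   | no _         = refl

    -- The empty flat would contribute P_M, about which induction says nothing yet. Putting `local`
    -- in its place completes the sum over all subsets, hence the transform.
    properSum-local : ∀ (M : Matroid N) → IsDualOf D M →
      (∀ F → F ≢ ⊥ → (F⊆ : F ⊆ ground M) →
        shift (ρ (ground M ─ F)) (coeff (P (contract M F F⊆))) ≗ local (ground M ─ F)) →
      local (ground M) +ˢ shift (ρ (ground M)) (coeff (properSum P M)) ≗ global (ground M)
    properSum-local M d ih i = begin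
      local S i +ᶻ shift (ρ S) (coeff (properSum P M)) i  ≡⟨ cong (local S i +ᶻ_) (shift-sumOverSubsets (ρ S) N (properTerm P M) i) ⟩
      local S i +ᶻ sumSubsets h i                         ≡⟨ sumSubsets-complement-⊥ S h local
          (λ j → trans (shift-cong (ρ S) (properTerm-⊥ P M) j) (shift-zero (ρ S) j))
          (λ F F≢⊥ F⊆ → properTerm-local M d F F≢⊥ F⊆ (ih F F≢⊥ F⊆)) (λ F F⊈ → properTerm-outside M F F⊈ (ρ S)) i ⟩
      overSubsets S local i                               ≡⟨ overSubsets-local S i ⟩
      global S i                                          ∎
      where
      open ≡-Reasoning
      S = ground M
      h : Subset N → Series
      h F = shift (ρ S) (coeff (properTerm P M F))

    Z-shift : ∀ (M : Matroid N) → Loopless M →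
              shift (ρ (ground M)) (coeff (P M)) +ˢ shift (ρ (ground M)) (coeff (properSum P M))
              ≗ shift (ρ (ground M)) (coeff (Z P M))
    Z-shift M ll i = trans (shift-distrib (ρ (ground M)) (coeff (P M)) (coeff (properSum P M)) i)
      (shift-cong (ρ (ground M)) (λ j → sym (Z-split P respects-≋ M ll j)) i)

    element : ∀ (M : Matroid N) → 0 < rk M → Nonempty (ground M)
    element M r>0 with nonempty? (ground M)
    ... | yes ne = ne
    ... | no ¬ne = contradiction (≤-trans r>0 (rank-≤-card M (ground M) id))
                     (subst (λ X → ¬ 1 ≤ⁿ ∣ X ∣) (sym (Empty-unique ¬ne)) (subst (λ n → ¬ 1 ≤ⁿ n) (sym (∣⊥∣≡0 N)) λ ()))

    -- The factor t^ρ moves the mirror sum from rk M to rk M + 2ρ, which is ρ + ∣ S ∣ by duality.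
    conditions : ∀ (M : Matroid N) → IsDualOf D M → 0 < rk M → ∃ λ m → suc m ≡ ρ (ground M) + ∣ ground M ∣ ×
                 Low 0 m (local (ground M)) × Pal 0 (suc m) (global (ground M))
    conditions M (S⊆E , _) r>0 = go (ρ S) refl
      where
      S = ground M
      x = proj₁ (element M r>0)
      x∈ = proj₂ (element M r>0)
      go : ∀ v → ρ S ≡ v → ∃ λ m → suc m ≡ v + ∣ S ∣ × Low 0 m (local S) × Pal 0 (suc m) (global S)
      go zero eq = contradiction (subst (1 ≤ⁿ_) eq (ρ>0 S⊆E x∈)) λ ()
      go (suc zero) eq = ∣ S ∣ , refl ,
        (λ i lt → trans (local-rank≤1 S⊆E (≤-reflexive eq) i) (circuit-low ∣ S ∣ i lt)) ,
        Pal-cong (λ i → sym (global-rank≤1 S⊆E (≤-reflexive eq) i))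
          (subst (λ n → Pal 0 (suc n) (circuitZ n)) (sym (card-remove S x x∈)) (circuitZ-pal ∣ S ─ ⁅ x ⁆ ∣))
      go (suc (suc zero)) eq = suc ∣ S ∣ , refl ,
        total-low parallel S x x∈ (spread S⊆E eq) , total-pal parallel S x x∈ (spread S⊆E eq)
      go (suc (suc (suc _))) eq = contradiction (subst (_≤ⁿ 2) eq (ρ≤2 S S⊆E)) λ { (s≤s (s≤s ())) }

  -- Both candidates have low degree and become palindromic when the same sum over nonempty flats is
  -- added, so `low-unique` applies. The fuel k bounds the ground set, which shrinks under
  -- contraction.
  P-local : ∀ k (M : Matroid N) → IsDualOf D M → ∣ ground M ∣ < k →
            shift (ρ (ground M)) (coeff (P M)) ≗ local (ground M)
  P-local (suc k) M d (s≤s le) with loopless? M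
  ... | no ¬ll = λ i → trans (trans (shift-cong (ρ (ground M)) (loops M ¬ll) i) (shift-zero (ρ (ground M)) i))
                             (sym (local-loops M d ¬ll i))
  ... | yes ll with rk M in eq
  ...   | zero  = local-rank0 M d ll eq
  ...   | suc r = low-unique m _ _ (shift (ρ S) (coeff (properSum P M)))
      (subst (λ n → Low 0 n (shift (ρ S) (coeff (P M)))) degree≡
        (shift-low (ρ S) λ i lt → degree M ll r>0 i (subst₂ _≤ⁿ_ (sym eq) (+-identityʳ (2 * i)) lt)))
      low
      (Pal-cong (λ i → sym (Z-shift M ll i))
        (subst (λ n → Pal 0 n (shift (ρ S) (coeff (Z P M)))) (trans size (sym m≡))
          (shift-pal (ρ S) (subst (λ n → Pal 0 n (coeff (Z P M))) eq
            (palindromic⇒Pal (rk M) (Z P M) (palindromic M ll))))))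
      (Pal-cong (λ i → sym (properSum-local M d ih i)) pal)
    where
    S = ground M
    r>0 : 0 < rk M
    r>0 = subst (0 <_) (sym eq) (s≤s z≤n)
    cond = conditions M d r>0
    m = proj₁ cond
    m≡ = proj₁ (proj₂ cond)
    low = proj₁ (proj₂ (proj₂ cond))
    pal = proj₂ (proj₂ (proj₂ cond))
    size : ρ S + (ρ S + suc r) ≡ ρ S + ∣ S ∣
    size = cong (ρ S +_) (trans (+-comm (ρ S) (suc r)) (trans (cong (_+ ρ S) (sym eq)) (dual-rk D M d)))
    degree≡ : ρ S + (ρ S + r) ≡ m
    degree≡ = suc-injective (trans (sym (trans (cong (ρ S +_) (+-suc (ρ S) r)) (+-suc (ρ S) (ρ S + r))))
                                   (trans size (sym m≡)))
    ih : ∀ F → F ≢ ⊥ → (F⊆ : F ⊆ S) → shift (ρ (S ─ F)) (coeff (P (contract M F F⊆))) ≗ local (S ─ F)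
    ih F F≢⊥ F⊆ = P-local k (contract M F F⊆) (dual-contract D M d F F⊆) (<-≤-trans smaller le)
      where
      smaller : ∣ S ─ F ∣ < ∣ S ∣
      smaller with nonempty? F
      ... | no ¬ne = contradiction (Empty-unique ¬ne) F≢⊥
      ... | yes (x , x∈) = subst (∣ S ─ F ∣ <_) (card-─ S F F⊆)
        (m<n+m _ (subst (_≤ⁿ ∣ F ∣) (∣⁅x⁆∣≡1 x) (p⊆q⇒∣p∣≤∣q∣ (⁅x⁆⊆ x∈))))

  Z-global : ∀ (M : Matroid N) → IsDualOf D M → Loopless M → shift (ρ (ground M)) (coeff (Z P M)) ≗ global (ground M)
  Z-global M d ll i = trans (sym (Z-shift M ll i)) (trans
    (cong (_+ᶻ shift (ρ (ground M)) (coeff (properSum P M)) i) (P-local _ M d ≤-refl i))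
    (properSum-local M d (λ F _ F⊆ → P-local _ (contract M F F⊆) (dual-contract D M d F F⊆) ≤-refl) i))

-- The dual of a coloopless matroid of corank 2

card-modular : ∀ {N} (A B : Subset N) → ∣ A ∪ B ∣ + ∣ A ∩ B ∣ ≡ ∣ A ∣ + ∣ B ∣
card-modular A B = begin
  ∣ A ∪ B ∣ + ∣ A ∩ B ∣            ≡⟨ cong₂ _+_ (trans (cong ∣_∣ union) (card-disjoint A (B ─ A)
                                        λ x∈A x∈ → proj₂ (x∈p─q⁻ B A x∈) x∈A)) (cong ∣_∣ (∩-comm A B)) ⟩
  ∣ A ∣ + ∣ B ─ A ∣ + ∣ B ∩ A ∣     ≡⟨ +-assoc ∣ A ∣ (∣ B ─ A ∣) (∣ B ∩ A ∣) ⟩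
  ∣ A ∣ + (∣ B ─ A ∣ + ∣ B ∩ A ∣)   ≡⟨ cong (∣ A ∣ +_) (trans (sym (card-disjoint (B ─ A) (B ∩ A)
                                        λ x∈ x∈′ → proj₂ (x∈p─q⁻ B A x∈) (p∩q⊆q B A x∈′))) (cong ∣_∣ rejoin)) ⟩
  ∣ A ∣ + ∣ B ∣                    ∎
  where
  open ≡-Reasoning
  union : A ∪ B ≡ A ∪ (B ─ A)
  union = ⊆-antisym to λ x∈ → [ p⊆p∪q B , q⊆p∪q A B ∘ p─q⊆p B A ]′ (x∈p∪q⁻ A (B ─ A) x∈)
    where
    to : A ∪ B ⊆ A ∪ (B ─ A)
    to {x} x∈ with x ∈? A
    ... | yes x∈A = p⊆p∪q (B ─ A) x∈A
    ... | no  x∉A = [ p⊆p∪q (B ─ A) , (λ x∈B → q⊆p∪q A (B ─ A) (x∈p∧x∉q⇒x∈p─q x∈B x∉A)) ]′ (x∈p∪q⁻ A B x∈)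
  rejoin : (B ─ A) ∪ (B ∩ A) ≡ B
  rejoin = ⊆-antisym (λ x∈ → [ p─q⊆p B A , p∩q⊆p B A ]′ (x∈p∪q⁻ (B ─ A) (B ∩ A) x∈)) from
    where
    from : B ⊆ (B ─ A) ∪ (B ∩ A)
    from {x} x∈B with x ∈? A
    ... | yes x∈A = q⊆p∪q (B ─ A) (B ∩ A) (x∈p∩q⁺ (x∈B , x∈A))
    ... | no  x∉A = p⊆p∪q (B ∩ A) (x∈p∧x∉q⇒x∈p─q x∈B x∉A)

rank-subadditive : ∀ {N} (M : Matroid N) A B → A ⊆ ground M → B ⊆ ground M →
                   rank M (A ∪ B) ≤ⁿ rank M A + rank M B
rank-subadditive M A B A⊆ B⊆ = ≤-trans (m≤m+n _ _) (rank-submodular M A B A⊆ B⊆)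

module _ {N} (M : Matroid N) (corank2 : rk M + 2 ≡ ∣ ground M ∣)
         (no-coloop : ∀ {x} → x ∈ ground M → rank M (ground M ─ ⁅ x ⁆) ≡ rk M) where

  private
    E = ground M
    r = rank M

    E─⊆ : ∀ X → E ─ X ⊆ E
    E─⊆ = p─q⊆p E

    double : ∀ {X} → X ⊆ E → E ─ (E ─ X) ≡ X
    double {X} X⊆E = ⊆-antisym to λ x∈ → x∈p∧x∉q⇒x∈p─q (X⊆E x∈) λ x∈′ → proj₂ (x∈p─q⁻ E X x∈′) x∈
      where
      to : E ─ (E ─ X) ⊆ X
      to {x} x∈ with x ∈? X
      ... | yes x∈X = x∈X
      ... | no  x∉X = let x∈E , x∉ = x∈p─q⁻ E (E ─ X) x∈ in contradiction (x∈p∧x∉q⇒x∈p─q x∈E x∉X) x∉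

    cover : ∀ (X Y : Subset N) → Y ⊆ X ∪ (Y ─ X)
    cover X Y {x} x∈Y with x ∈? X
    ... | yes x∈X = p⊆p∪q (Y ─ X) x∈X
    ... | no  x∉X = q⊆p∪q X (Y ─ X) (x∈p∧x∉q⇒x∈p─q x∈Y x∉X)

    dual-rank : Subset N → ℕ
    dual-rank X = (∣ X ∣ + r (E ─ X)) ∸ rk M

    -- Subadditivity gives rk M ≤ r X + r (E ─ X), so the subtraction in `dual-rank` is never
    -- truncated.
    dual-rank-+ : ∀ {X} → X ⊆ E → dual-rank X + rk M ≡ ∣ X ∣ + r (E ─ X)
    dual-rank-+ {X} X⊆E = m∸n+n≡m (begin
      rk M                    ≤⟨ rank-mono M E (X ∪ (E ─ X)) (cover X E) (λ x∈ → [ X⊆E , E─⊆ X ]′ (x∈p∪q⁻ X (E ─ X) x∈)) ⟩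
      r (X ∪ (E ─ X))         ≤⟨ rank-subadditive M X (E ─ X) X⊆E (E─⊆ X) ⟩
      r X + r (E ─ X)         ≤⟨ +-monoˡ-≤ (r (E ─ X)) (rank-≤-card M X X⊆E) ⟩
      ∣ X ∣ + r (E ─ X)        ∎)
      where open ≤-Reasoning

    dual-rank-E : dual-rank E ≡ 2
    dual-rank-E = +-cancelʳ-≡ (rk M) (dual-rank E) 2 (begin
      dual-rank E + rk M   ≡⟨ dual-rank-+ id ⟩
      ∣ E ∣ + r (E ─ E)     ≡⟨ cong (λ X → ∣ E ∣ + r X) (Empty-unique λ (x , x∈) → let x∈E , x∉E = x∈p─q⁻ E E x∈ in x∉E x∈E) ⟩
      ∣ E ∣ + r ⊥           ≡⟨ cong₂ _+_ (sym corank2) (rank-⊥ M) ⟩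
      rk M + 2 + 0         ≡⟨ +-identityʳ (rk M + 2) ⟩
      rk M + 2             ≡⟨ +-comm (rk M) 2 ⟩
      2 + rk M             ∎)
      where open ≡-Reasoning

    dual-rank-⊥ : dual-rank ⊥ ≡ 0
    dual-rank-⊥ = trans (cong₂ (λ a X → (a + r X) ∸ rk M) (∣⊥∣≡0 N) (p─⊥≡p E)) (n∸n≡0 (rk M))

    -- A loop of the dual would be a coloop of M, which `no-coloop` excludes.
    dual-rank-singleton : ∀ {x} → x ∈ E → dual-rank ⁅ x ⁆ ≡ 1
    dual-rank-singleton {x} x∈ =
      trans (cong₂ (λ a b → (a + b) ∸ rk M) (∣⁅x⁆∣≡1 x) (no-coloop x∈)) (m+n∸n≡m 1 (rk M))

    dual-rank-mono : ∀ X Y → X ⊆ Y → Y ⊆ E → dual-rank X ≤ⁿ dual-rank Y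
    dual-rank-mono X Y X⊆Y Y⊆E = ∸-monoˡ-≤ (rk M) (begin
      ∣ X ∣ + r (E ─ X)                    ≤⟨ +-monoʳ-≤ ∣ X ∣ (rank-mono M (E ─ X) ((E ─ Y) ∪ (Y ─ X)) difference joined) ⟩
      ∣ X ∣ + r ((E ─ Y) ∪ (Y ─ X))        ≤⟨ +-monoʳ-≤ ∣ X ∣ (rank-subadditive M (E ─ Y) (Y ─ X) (E─⊆ Y) Y─X⊆) ⟩
      ∣ X ∣ + (r (E ─ Y) + r (Y ─ X))      ≤⟨ +-monoʳ-≤ ∣ X ∣ (+-monoʳ-≤ (r (E ─ Y)) (rank-≤-card M (Y ─ X) Y─X⊆)) ⟩
      ∣ X ∣ + (r (E ─ Y) + ∣ Y ─ X ∣)       ≡⟨ cong (∣ X ∣ +_) (+-comm (r (E ─ Y)) _) ⟩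
      ∣ X ∣ + (∣ Y ─ X ∣ + r (E ─ Y))       ≡⟨ +-assoc ∣ X ∣ _ _ ⟨
      ∣ X ∣ + ∣ Y ─ X ∣ + r (E ─ Y)         ≡⟨ cong (_+ r (E ─ Y)) (card-─ Y X X⊆Y) ⟩
      ∣ Y ∣ + r (E ─ Y)                    ∎)
      where
      open ≤-Reasoning
      Y─X⊆ : Y ─ X ⊆ E
      Y─X⊆ = Y⊆E ∘ p─q⊆p Y X
      joined : (E ─ Y) ∪ (Y ─ X) ⊆ E
      joined x∈ = [ E─⊆ Y , Y─X⊆ ]′ (x∈p∪q⁻ (E ─ Y) (Y ─ X) x∈)
      difference : E ─ X ⊆ (E ─ Y) ∪ (Y ─ X)
      difference {x} x∈ with x ∈? Y | x∈p─q⁻ E X x∈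
      ... | yes x∈Y | _ , x∉X = q⊆p∪q (E ─ Y) (Y ─ X) (x∈p∧x∉q⇒x∈p─q x∈Y x∉X)
      ... | no  x∉Y | x∈E , _ = p⊆p∪q (Y ─ X) (x∈p∧x∉q⇒x∈p─q x∈E x∉Y)

    -- Complements exchange unions and intersections, so X ↦ r (E ─ X) is submodular too, and
    -- cardinality is modular.
    dual-rank-submodular : ∀ X Y → X ⊆ E → Y ⊆ E →
                           dual-rank (X ∪ Y) + dual-rank (X ∩ Y) ≤ⁿ dual-rank X + dual-rank Y
    dual-rank-submodular X Y X⊆E Y⊆E = +-cancelʳ-≤ (rk M + rk M) _ _ (begin
      dual-rank (X ∪ Y) + dual-rank (X ∩ Y) + (rk M + rk M)
        ≡⟨ interchange (dual-rank (X ∪ Y)) _ _ _ ⟩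
      (dual-rank (X ∪ Y) + rk M) + (dual-rank (X ∩ Y) + rk M)
        ≡⟨ cong₂ _+_ (dual-rank-+ (λ x∈ → [ X⊆E , Y⊆E ]′ (x∈p∪q⁻ X Y x∈))) (dual-rank-+ (X⊆E ∘ p∩q⊆p X Y)) ⟩
      (∣ X ∪ Y ∣ + r (E ─ (X ∪ Y))) + (∣ X ∩ Y ∣ + r (E ─ (X ∩ Y)))
        ≡⟨ interchange ∣ X ∪ Y ∣ (r (E ─ (X ∪ Y))) (∣ X ∩ Y ∣) _ ⟩
      (∣ X ∪ Y ∣ + ∣ X ∩ Y ∣) + (r (E ─ (X ∪ Y)) + r (E ─ (X ∩ Y)))
        ≤⟨ +-mono-≤ (≤-reflexive (card-modular X Y)) complements ⟩
      (∣ X ∣ + ∣ Y ∣) + (r (E ─ X) + r (E ─ Y))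
        ≡⟨ interchange ∣ X ∣ (∣ Y ∣) (r (E ─ X)) _ ⟩
      (∣ X ∣ + r (E ─ X)) + (∣ Y ∣ + r (E ─ Y))
        ≡⟨ cong₂ _+_ (dual-rank-+ X⊆E) (dual-rank-+ Y⊆E) ⟨
      (dual-rank X + rk M) + (dual-rank Y + rk M)
        ≡⟨ interchange (dual-rank X) _ _ _ ⟩
      dual-rank X + dual-rank Y + (rk M + rk M) ∎)
      where
      open ≤-Reasoning
      interchange : ∀ a b c d → (a + b) + (c + d) ≡ (a + c) + (b + d)
      interchange = ℕ-Ring.solve-∀
      joined⊆ : (E ─ X) ∪ (E ─ Y) ⊆ E
      joined⊆ x∈ = [ E─⊆ X , E─⊆ Y ]′ (x∈p∪q⁻ (E ─ X) (E ─ Y) x∈)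
      meet : E ─ (X ∪ Y) ⊆ (E ─ X) ∩ (E ─ Y)
      meet x∈ = let x∈E , x∉ = x∈p─q⁻ E (X ∪ Y) x∈ in
        x∈p∩q⁺ (x∈p∧x∉q⇒x∈p─q x∈E (x∉ ∘ p⊆p∪q Y) , x∈p∧x∉q⇒x∈p─q x∈E (x∉ ∘ q⊆p∪q X Y))
      join : E ─ (X ∩ Y) ⊆ (E ─ X) ∪ (E ─ Y)
      join {x} x∈ with x ∈? X | x∈p─q⁻ E (X ∩ Y) x∈
      ... | no  x∉X | x∈E , _  = p⊆p∪q (E ─ Y) (x∈p∧x∉q⇒x∈p─q x∈E x∉X)
      ... | yes x∈X | x∈E , x∉ = q⊆p∪q (E ─ X) (E ─ Y) (x∈p∧x∉q⇒x∈p─q x∈E λ x∈Y → x∉ (x∈p∩q⁺ (x∈X , x∈Y)))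
      complements : r (E ─ (X ∪ Y)) + r (E ─ (X ∩ Y)) ≤ⁿ r (E ─ X) + r (E ─ Y)
      complements = begin
        r (E ─ (X ∪ Y)) + r (E ─ (X ∩ Y))              ≡⟨ +-comm (r (E ─ (X ∪ Y))) _ ⟩
        r (E ─ (X ∩ Y)) + r (E ─ (X ∪ Y))              ≤⟨ +-mono-≤ (rank-mono M _ _ join joined⊆)
                                                            (rank-mono M _ _ meet (E─⊆ X ∘ p∩q⊆p (E ─ X) (E ─ Y))) ⟩
        r ((E ─ X) ∪ (E ─ Y)) + r ((E ─ X) ∩ (E ─ Y))  ≤⟨ rank-submodular M (E ─ X) (E ─ Y) (E─⊆ X) (E─⊆ Y) ⟩
        r (E ─ X) + r (E ─ Y)                          ∎

  dualRank : DualRank (ground M)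
  dualRank = record
    { ρ            = dual-rank
    ; ρ-⊥          = dual-rank-⊥
    ; ρ-singleton  = dual-rank-singleton
    ; ρ-mono       = dual-rank-mono
    ; ρ-submodular = dual-rank-submodular
    ; ρ-E          = dual-rank-E
    }

  open DualRank dualRank using (ρ; global; parallel; spread)

  ρ-+ : ∀ {X} → X ⊆ E → ρ X + rk M ≡ ∣ X ∣ + r (E ─ X)
  ρ-+ = dual-rank-+

  dualRank-isDual : IsDualOf dualRank M
  dualRank-isDual = id , λ A A⊆ → +-cancelʳ-≡ (rk M) _ _ (begin
    r A + ρ E + rk M                   ≡⟨ cong (λ k → r A + k + rk M) dual-rank-E ⟩
    r A + 2 + rk M                     ≡⟨ rotate (r A) 2 (rk M) ⟩
    (rk M + 2) + r A                   ≡⟨ cong (_+ r A) (trans corank2 (sym (card-─ E A A⊆))) ⟩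
    ∣ A ∣ + ∣ E ─ A ∣ + r A             ≡⟨ cong (λ X → ∣ A ∣ + ∣ E ─ A ∣ + r X) (double A⊆) ⟨
    ∣ A ∣ + ∣ E ─ A ∣ + r (E ─ (E ─ A)) ≡⟨ +-assoc ∣ A ∣ (∣ E ─ A ∣) _ ⟩
    ∣ A ∣ + (∣ E ─ A ∣ + r (E ─ (E ─ A))) ≡⟨ cong (∣ A ∣ +_) (dual-rank-+ (E─⊆ A)) ⟨
    ∣ A ∣ + (ρ (E ─ A) + rk M)          ≡⟨ +-assoc ∣ A ∣ _ _ ⟨
    ∣ A ∣ + ρ (E ─ A) + rk M            ∎)
    where
    open ≡-Reasoning
    rotate : ∀ a b c → a + b + c ≡ (c + b) + a
    rotate = ℕ-Ring.solve-∀

  -- The offset 2 is ρ E: `global E` is t² Z_M.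
  coeff-Z : (P : Assignment) → IsKazhdanLusztig P → Loopless M → ∀ i → coeff (Z P M) i ≡ global E (2 + i)
  coeff-Z P isKL ll i = trans (cong (λ k → shift k (coeff (Z P M)) (2 + i)) (sym dual-rank-E))
    (Z-global P isKL dualRank M dualRank-isDual ll (2 + i))

  -- The subtracted defects are nonnegative. The bound depends on ∣ E ∣ alone, and by `global-U` the
  -- uniform matroid attains it.
  global-≼ : global E ≼ circuitZ ∣ E ∣ +ˢ antidiagonal globalDefect ∣ E ∣
  global-≼ i = subst (global E i ≤_) (ℤ.+-identityʳ _)
    (ℤ.+-monoʳ-≤ ((circuitZ ∣ E ∣ +ˢ antidiagonal globalDefect (∣ E ∣)) i)
      (ℤ.neg-mono-≤ (defects-nonneg parallel E (spread id dual-rank-E) i)))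

Z-loops : ∀ (P : Assignment) {N} (M : Matroid N) → ¬ Loopless M → Z P M ≡ []
Z-loops P M ¬ll with loopless? M
... | yes ll = contradiction ll ¬ll
... | no _   = refl

coloopless⇒rank : ∀ {N} (M : Matroid N) → Coloopless M →
                  ∀ {x} → x ∈ ground M → rank M (ground M ─ ⁅ x ⁆) ≡ rk M
coloopless⇒rank M cl {x} x∈ = ≤-antisym (rank-mono M _ _ (p─q⊆p (ground M) ⁅ x ⁆) id)
  (≮⇒≥ λ lt → cl x (x∈ , every-basis lt))
  where
  every-basis : rank M (ground M ─ ⁅ x ⁆) < rk M → ∀ B → IsBasis M B → x ∈ B
  every-basis lt B ((B⊆ , _) , full) with x ∈? B
  ... | yes x∈B = x∈B
  ... | no  x∉B = contradiction (subst (_≤ⁿ rank M (ground M ─ ⁅ x ⁆)) full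
          (rank-mono M B (ground M ─ ⁅ x ⁆) (λ y∈ → x∈p∧x≢y⇒x∈p-y (B⊆ y∈) λ { refl → x∉B y∈ }) (p─q⊆p (ground M) ⁅ x ⁆)))
          (<⇒≱ lt)

-- The uniform matroid and the comparison

module UniformCorank2 (m : ℕ) where

  U : Matroid (2 + m)
  U = uniform m (2 + m)

  rk-U : rk U ≡ m
  rk-U = trans (cong (_⊓ m) (∣⊤∣≡n (2 + m))) (m≥n⇒m⊓n≡n (m≤n+m m 2))

  corank2 : rk U + 2 ≡ ∣ ground U ∣
  corank2 = trans (cong (_+ 2) rk-U) (trans (+-comm m 2) (sym (∣⊤∣≡n (2 + m))))

  card-complement : ∀ (X : Subset (2 + m)) → ∣ X ∣ + ∣ ⊤ ─ X ∣ ≡ 2 + m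
  card-complement X = trans (card-─ ⊤ X (⊆-max X)) (∣⊤∣≡n (2 + m))

  no-coloop : ∀ {x} → x ∈ ground U → rank U (ground U ─ ⁅ x ⁆) ≡ rk U
  no-coloop {x} _ = trans (cong (_⊓ m) (suc-injective
      (trans (cong (λ k → k + ∣ ⊤ ─ ⁅ x ⁆ ∣) (sym (∣⁅x⁆∣≡1 x))) (card-complement ⁅ x ⁆))))
    (trans (m≥n⇒m⊓n≡n (n≤1+n m)) (sym rk-U))

  open DualRank (dualRank U corank2 no-coloop)

  -- Removing two of the m + 2 elements leaves m, still of full rank; the dual is U_{2,m+2}.
  not-parallel : ∀ {x y} → x ≢ y → ρ (pair x y) ≡ 2
  not-parallel {x} {y} x≢y = +-cancelʳ-≡ (rk U) _ 2 (trans (ρ-+ U corank2 no-coloop (⊆-max (pair x y)))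
    (cong₂ _+_ card (trans (cong (_⊓ m) (+-cancelˡ-≡ 2 _ m
        (trans (cong (λ k → k + ∣ ⊤ ─ pair x y ∣) (sym card)) (card-complement (pair x y)))))
      (trans (⊓-idem m) (sym rk-U)))))
    where
    card : ∣ pair x y ∣ ≡ 2
    card = trans (card-disjoint ⁅ x ⁆ ⁅ y ⁆ λ z∈x z∈y → x≢y (trans (sym (x∈⁅y⁆⇒x≡y x z∈x)) (x∈⁅y⁆⇒x≡y y z∈y)))
                 (cong₂ _+_ (∣⁅x⁆∣≡1 x) (∣⁅x⁆∣≡1 y))

  global-U : global ⊤ ≗ circuitZ (2 + m) +ˢ antidiagonal globalDefect (2 + m)
  global-U i = trans (cong₂ _-ᶻ_ (cong (λ n → (circuitZ n +ˢ antidiagonal globalDefect n) i) (∣⊤∣≡n (2 + m)))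
                                 (defects-trivial parallel ⊤ none i)) (ℤ.+-identityʳ _)
    where
    none : ∀ x → Empty (later parallel x ∩ ⊤)
    none x (y , y∈) = contradiction
      (subst (_≤ⁿ 1) (not-parallel {x} {y} λ { refl → x∉later parallel x y∈l })
        (parallel⇒≤1 {x} {y} (proj₁ (later⁻ parallel x y∈l))))
      λ { (s≤s ()) }
      where y∈l = proj₁ (x∈p∩q⁻ (later parallel x) ⊤ y∈)

  loopless : 0 < m → Loopless U
  loopless 0<m x (_ , r≡0) = contradiction (trans (sym (trans (cong (_⊓ m) (∣⁅x⁆∣≡1 x)) (m≤n⇒m⊓n≡m 0<m))) r≡0) λ ()

module _ (P : Assignment) (isKL : IsKazhdanLusztig P) {N} (M : Matroid N) (m : ℕ)
         (size : ∣ ground M ∣ ≡ 2 + m) (corank : rk M ≡ m) (coloopless : Coloopless M) where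

  private
    open UniformCorank2 m
    E = ground M

    no-coloop-M : ∀ {x} → x ∈ E → rank M (E ─ ⁅ x ⁆) ≡ rk M
    no-coloop-M = coloopless⇒rank M coloopless

    corank2-M : rk M + 2 ≡ ∣ E ∣
    corank2-M = trans (cong (_+ 2) corank) (trans (+-comm m 2) (sym size))

    open DualRank (dualRank U corank2 no-coloop) using () renaming (global to global-uniform)
    open DualRank (dualRank M corank2-M no-coloop-M) using () renaming (global to global-M)

    -- If M has loops, then Z_M = 0 by convention, and this is what the bound asserts.
    Z-uniform-nonneg : ∀ i → Dec (Loopless U) → 0ℤ ≤ coeff (Z P U) i
    Z-uniform-nonneg i (no loopy) rewrite Z-loops P U loopy = ℤ.≤-refl
    Z-uniform-nonneg i (yes ll) =
      subst (0ℤ ≤_) (sym (trans (coeff-Z U corank2 no-coloop P isKL ll i) (global-U (2 + i))))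
        (global-head-nonneg (suc m) (2 + i))

    bound : Dec (Loopless M) → ∀ i → coeff (Z P M) i ≤ coeff (Z P U) i
    bound (no loopy) i rewrite Z-loops P M loopy = Z-uniform-nonneg i (loopless? U)
    bound (yes ll)   i = begin
      coeff (Z P M) i                                                  ≡⟨ coeff-Z M corank2-M no-coloop-M P isKL ll i ⟩
      global-M E (2 + i)                                               ≤⟨ global-≼ M corank2-M no-coloop-M (2 + i) ⟩
      (circuitZ ∣ E ∣ +ˢ antidiagonal globalDefect (∣ E ∣)) (2 + i)      ≡⟨ cong (λ n → (circuitZ n +ˢ antidiagonal globalDefect n) (2 + i)) size ⟩
      (circuitZ (2 + m) +ˢ antidiagonal globalDefect (2 + m)) (2 + i)  ≡⟨ global-U (2 + i) ⟨
      global-uniform ⊤ (2 + i)                                         ≡⟨ coeff-Z U corank2 no-coloop P isKL (loopless rank>0) i ⟨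
      coeff (Z P U) i                                                  ∎
      where
      open ℤ.≤-Reasoning
      -- A loopless M on m + 2 > 0 elements has positive rank, which makes U loopless as well.
      rank>0 : 0 < m
      rank>0 = subst (0 <_) corank (loopless-rank>0 M ll E id λ e →
        contradiction (trans (sym size) (trans (cong ∣_∣ e) (∣⊥∣≡0 N))) λ ())

  corank2-bound : ∀ i → coeff (Z P M) i ≤ coeff (Z P (uniform m (2 + m))) i
  corank2-bound = bound (loopless? M)

theorem9p10 : (P : Assignment) → IsKazhdanLusztig P →
    ∀ {N} (M : Matroid N) (n : ℕ) → ∣ ground M ∣ ≡ n → rk M + 2 ≡ n →
    Coloopless M →
    ∀ i → coeff (Z P M) i ≤ coeff (Z P (uniform (n ∸ 2) n)) i
-- Replacing n by 2 + rk M lets `n ∸ 2` reduce to `rk M`.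
theorem9p10 P isKL M n size corank coloopless with refl ← trans (sym corank) (+-comm (rk M) 2) =
  corank2-bound P isKL M (rk M) size refl coloopless
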